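{- Let $p$ be a prime, $q=p^l$, $n\ge 2$ and $k\ge 1$ integers, and assume $(n,q)\notin\{(2,2),(2,3)\}$. Let $g\in SL_n(\mathbb F_q)\setminus Z_{n,q}$. Then: (a) $P_{k,n,q}=M_n(\mathbb F_q)$ if and only if $g\in L_{P_{k,n,q}}$. (b) If $p\nmid k$ and $-1\in\{x^d\mid x\in\mathbb F_q\}$, where $d=\gcd(k,q-1)$, then $Q_{k,n,q}=M_n(\mathbb F_q)$ if and only if $g\in L_{Q_{k,n,q}}$. (c) If $p\nmid k$, then $Q_{k,n,q}\cup\{0_n\}=M_n(\mathbb F_q)$ if and only if $g\in L_{Q_{k,n,q}}$.
   Context: $Z_{n,q}=\{aI_n\mid a\in\mathbb F_q,\ a^n=1\}$ is the center of $SL_n(\mathbb F_q)$. $P_{k,n,q}=\{A^k+B^k\mid A,B\in M_n(\mathbb F_q)\}$ and $Q_{k,n,q}=\{A^k+B^k\mid A,B\in GL_n(\mathbb F_q)\}$. For a nonempty subset $S\subset M_n(\mathbb F_q)$, $L_S=\{g\in GL_n(\mathbb F_q)\mid gS=S\}$, where $gS=\{gs\mid s\in S\}$. -}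

module Defs where

open import Level using (0ℓ)
open import Algebra.Bundles using (CommutativeRing)
open import Data.Nat as ℕ using (ℕ; zero; suc)
open import Data.Fin using (Fin; zero; suc; punchIn; toℕ)
open import Data.Sum using (_⊎_)
open import Data.Product using (Σ; ∃; _×_; _,_)
open import Relation.Nullary using (¬_)
open import Relation.Binary.PropositionalEquality using (_≡_)

record FiniteField (q : ℕ) : Set₁ where
  field
    commRing : CommutativeRing 0ℓ 0ℓ
  open CommutativeRing commRing public
  field
    1≉0     : ¬ (1# ≈ 0#)
    inverse : ∀ x → ¬ (x ≈ 0#) → ∃ λ y → (x * y) ≈ 1#
    enum    : Fin q → Carrier
    enum-injective  : ∀ i j → enum i ≈ enum j → i ≡ j
    enum-surjective : ∀ x → ∃ λ i → enum i ≈ x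

module Matrices {q : ℕ} (F : FiniteField q) where
  open FiniteField F hiding (zero)

  pow : Carrier → ℕ → Carrier
  pow x zero    = 1#
  pow x (suc k) = x * pow x k

  ∑ : ∀ n → (Fin n → Carrier) → Carrier
  ∑ zero    f = 0#
  ∑ (suc n) f = f zero + ∑ n (λ i → f (suc i))

  Mat : ℕ → Set
  Mat n = Fin n → Fin n → Carrier

  _≈M_ : ∀ {n} → Mat n → Mat n → Set
  A ≈M B = ∀ i j → A i j ≈ B i j

  _+M_ : ∀ {n} → Mat n → Mat n → Mat n
  (A +M B) i j = A i j + B i j

  _*M_ : ∀ {n} → Mat n → Mat n → Mat n
  _*M_ {n} A B i j = ∑ n (λ r → A i r * B r j)

  0M : ∀ {n} → Mat n
  0M i j = 0#

  scalar : ∀ {n} → Carrier → Mat n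
  scalar a zero    zero    = a
  scalar a zero    (suc j) = 0#
  scalar a (suc i) zero    = 0#
  scalar a (suc i) (suc j) = scalar a i j

  I : ∀ {n} → Mat n
  I = scalar 1#

  _^M_ : ∀ {n} → Mat n → ℕ → Mat n
  A ^M zero  = I
  A ^M suc k = A *M (A ^M k)

  sign : ℕ → Carrier → Carrier
  sign zero    x = x
  sign (suc m) x = - sign m x

  det : ∀ {n} → Mat n → Carrier
  det {zero}  A = 1#
  det {suc n} A =
    ∑ (suc n) (λ j → sign (toℕ j) (A zero j * det {n} (λ r c → A (suc r) (punchIn j c))))

  InGL : ∀ {n} → Mat n → Set
  InGL {n} g = ∃ λ h → ((g *M h) ≈M I) × ((h *M g) ≈M I)

  InSL : ∀ {n} → Mat n → Set
  InSL g = det g ≈ 1#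

  InZ : ∀ n → Mat n → Set
  InZ n g = ∃ λ a → (pow a n ≈ 1#) × (g ≈M scalar a)

  P : ℕ → ∀ n → Mat n → Set
  P k n M = ∃ λ A → ∃ λ B → ((A ^M k) +M (B ^M k)) ≈M M

  Q : ℕ → ∀ n → Mat n → Set
  Q k n M = ∃ λ A → ∃ λ B → InGL A × InGL B × (((A ^M k) +M (B ^M k)) ≈M M)

  IsAll : ∀ {n} → (Mat n → Set) → Set
  IsAll {n} S = (M : Mat n) → S M

  IsAllWithZero : ∀ {n} → (Mat n → Set) → Set
  IsAllWithZero {n} S = (M : Mat n) → S M ⊎ (M ≈M 0M)

  InL : ∀ {n} → (Mat n → Set) → Mat n → Set
  InL {n} S g = InGL g
    × ((s : Mat n) → S s → S (g *M s))
    × ((t : Mat n) → S t → ∃ λ s → S s × ((g *M s) ≈M t))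

{-# OPTIONS --safe #-}
module Submission where

-- Let S be P or Q. The group L_S is normalised by GL_n because S is stable under conjugation.
-- If h ∈ L_S has a left eigenvector φ (φ h = b φ) and h u ≠ b u for some u with φ u = 0, then the
-- commutator of h with the transvection I + u φ is again a nontrivial transvection; a suitable h is
-- g itself or a commutator of g (this is where (n , q) ≠ (2 , 2), (2 , 3) enters). All nontrivial
-- transvections are conjugate in GL_n, so S is stable under all elementary row and column operations.
-- With these, every nonzero matrix can be given constant diagonal 2, and such a matrix is a sum of
-- an upper and a lower unitriangular matrix; these have p-power order, hence k-th roots when p ∤ k.
-- For P they bring every matrix to a sum of two idempotents.

-- A commutator `h t h⁻¹ t⁻¹` with `t = I + u φ` is a product of two rank-one perturbations of `I`.
-- It is again one as soon as their functionals are proportional, and a left eigenvector `φ` of `h`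
-- ensures this. Over a finite field `g` need not have an eigenvector, so a commutator of `g` is
-- built to have a prescribed one. `det g = 1` enters twice: it makes `g` invertible, and it puts
-- every scalar `g` into `Z`. Transvections have determinant 1, so single rows cannot be rescaled; a
-- pivot 1 arises by adding columns, which takes two of them. They also carry the zero matrix only
-- to itself: it is the gap between (b) and (c), and a `k`-th root of -1 fills it. The diagonal
-- value 2 is 1 + 1, from two unitriangular summands. Their roots may fail to exist when `p` divides
-- `k`; idempotents, each its own `k`-th power, serve (a) for every `k`, but being singular in
-- general they do not serve `Q`.

open import Defs
open import Level using (0ℓ)
open import Algebra.Bundles using (CommutativeRing; Monoid)
open import Data.Nat as ℕ using (ℕ; zero; suc; s≤s; z≤n; _^_; _≥_; _∸_; NonZero)
import Data.Nat.Properties as ℕ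
open import Data.Nat.Divisibility using (_∣_; ∣-trans; ∣1⇒≡1)
open import Data.Nat.GCD using (gcd; gcd-GCD; gcd[m,n]≢0; gcd-identityʳ; module Bézout)
open import Data.Nat.Coprimality using (Coprime; coprime-divisor; coprime⇒gcd≡1)
open import Data.Nat.Primality using (Prime; prime⇒irreducible; prime⇒nonZero)
import Data.Nat.Solver
open import Data.Integer as ℤ using (ℤ; +_; -[1+_])
import Data.Integer.Properties as ℤ
open import Data.Fin as Fin using (Fin; zero; suc; punchIn; toℕ; inject₁; fromℕ<)
import Data.Fin.Properties as Fin
open import Data.Fin.Permutation using (Permutation; permutation; _⟨$⟩ʳ_; remove; punchIn-permute)
open import Data.Maybe using (map)
open import Data.Sum using (_⊎_; inj₁; inj₂; [_,_])
open import Data.Product using (∃; ∃₂; _×_; _,_; proj₁; proj₂)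
open import Data.Empty using (⊥-elim)
open import Function using (_∘_)
open import Function.Bundles using (_⇔_; mk⇔)
open import Relation.Nullary using (¬_; Dec; yes; no)
open import Relation.Nullary.Decidable using (map′; ¬?; _×-dec_; decidable-stable; dec⇒maybe)
open import Relation.Binary.PropositionalEquality as ≡ using (_≡_; _≢_)

-- Ring solver for commutative rings

-- Coefficients in ℤ, where equality computes, let the ring solver cancel terms such as x - x.
module IntegerCoefficients (R : CommutativeRing 0ℓ 0ℓ) where
  open CommutativeRing R hiding (zero)
  open import Algebra.Properties.Semiring.Mult.TCOptimised semiring using (1+×; ×-homo-+; ×1-homo-*) renaming (_×_ to _·_)
  open import Algebra.Properties.Ring ring using (-‿distribˡ-*; -‿distribʳ-*; -0#≈0#; -‿involutive; -‿+-comm)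
  open import Algebra.Solver.Ring.AlmostCommutativeRing using (AlmostCommutativeRing; fromCommutativeRing; _-Raw-AlmostCommutative⟶_)
  open import Relation.Binary.Reasoning.Setoid setoid

  private
    -- With these optimised multiples `1 · 1#` reduces to `1#`, so `con (+ 1)` in a solver equation
    -- is `1#` itself.
    ⟦_⟧ℤ : ℤ → Carrier
    ⟦ + n      ⟧ℤ = n · 1#
    ⟦ -[1+ n ] ⟧ℤ = - (suc n · 1#)

    neg : ∀ i → ⟦ ℤ.- i ⟧ℤ ≈ - ⟦ i ⟧ℤ
    neg (+ zero)  = sym -0#≈0#
    neg (+ suc n) = refl
    neg -[1+ n ]  = sym (-‿involutive _)

    shift : ∀ a x y → (a + x) - (a + y) ≈ x - y
    shift a x y = begin
      (a + x) - (a + y)       ≈⟨ +-cong (+-comm a x) (sym (-‿+-comm a y)) ⟩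
      (x + a) + (- a + - y)   ≈⟨ +-assoc x a _ ⟩
      x + (a + (- a + - y))   ≈⟨ +-congˡ (sym (+-assoc a (- a) (- y))) ⟩
      x + ((a - a) + - y)     ≈⟨ +-congˡ (+-congʳ (-‿inverseʳ a)) ⟩
      x + (0# + - y)          ≈⟨ +-congˡ (+-identityˡ _) ⟩
      x - y                   ∎

    diff : ∀ m n → ⟦ m ℤ.⊖ n ⟧ℤ ≈ m · 1# - n · 1#
    diff zero    zero    = sym (-‿inverseʳ 0#)
    diff zero    (suc n) = sym (+-identityˡ _)
    diff (suc m) zero    = sym (trans (+-congˡ -0#≈0#) (+-identityʳ _))
    diff (suc m) (suc n) = begin
      ⟦ suc m ℤ.⊖ suc n ⟧ℤ               ≡⟨ ≡.cong ⟦_⟧ℤ (ℤ.[1+m]⊖[1+n]≡m⊖n m n) ⟩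
      ⟦ m ℤ.⊖ n ⟧ℤ                       ≈⟨ diff m n ⟩
      m · 1# - n · 1#                    ≈⟨ shift 1# _ _ ⟨
      (1# + m · 1#) - (1# + n · 1#)      ≈⟨ +-cong (1+× m 1#) (-‿cong (1+× n 1#)) ⟨
      suc m · 1# - suc n · 1#            ∎

    add : ∀ i j → ⟦ i ℤ.+ j ⟧ℤ ≈ ⟦ i ⟧ℤ + ⟦ j ⟧ℤ
    add (+ m)    (+ n)    = ×-homo-+ 1# m n
    add (+ m)    -[1+ n ] = diff m (suc n)
    add -[1+ m ] (+ n)    = trans (diff n (suc m)) (+-comm _ _)
    add -[1+ m ] -[1+ n ] = begin
      - (suc (suc (m ℕ.+ n)) · 1#)       ≡⟨ ≡.cong (λ k → - (suc k · 1#)) (ℕ.+-suc m n) ⟨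
      - ((suc m ℕ.+ suc n) · 1#)         ≈⟨ -‿cong (×-homo-+ 1# (suc m) (suc n)) ⟩
      - (suc m · 1# + suc n · 1#)        ≈⟨ -‿+-comm _ _ ⟨
      - (suc m · 1#) + - (suc n · 1#)    ∎

    mul : ∀ i j → ⟦ i ℤ.* j ⟧ℤ ≈ ⟦ i ⟧ℤ * ⟦ j ⟧ℤ
    mul (+ m) (+ n) = trans (reflexive (≡.cong ⟦_⟧ℤ (ℤ.+◃n≡+n (m ℕ.* n)))) (×1-homo-* m n)
    mul (+ m) -[1+ n ] = begin
      ⟦ + m ℤ.* -[1+ n ] ⟧ℤ        ≡⟨ ≡.cong ⟦_⟧ℤ (ℤ.neg-distribʳ-* (+ m) (+ suc n)) ⟨
      ⟦ ℤ.- (+ m ℤ.* + suc n) ⟧ℤ   ≈⟨ neg (+ m ℤ.* + suc n) ⟩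
      - ⟦ + m ℤ.* + suc n ⟧ℤ       ≈⟨ -‿cong (mul (+ m) (+ suc n)) ⟩
      - (m · 1# * (suc n · 1#))    ≈⟨ -‿distribʳ-* _ _ ⟩
      m · 1# * - (suc n · 1#)      ∎
    mul -[1+ m ] (+ n) = begin
      ⟦ -[1+ m ] ℤ.* + n ⟧ℤ        ≡⟨ ≡.cong ⟦_⟧ℤ (ℤ.neg-distribˡ-* (+ suc m) (+ n)) ⟨
      ⟦ ℤ.- (+ suc m ℤ.* + n) ⟧ℤ   ≈⟨ neg (+ suc m ℤ.* + n) ⟩
      - ⟦ + suc m ℤ.* + n ⟧ℤ       ≈⟨ -‿cong (mul (+ suc m) (+ n)) ⟩
      - (suc m · 1# * (n · 1#))    ≈⟨ -‿distribˡ-* _ _ ⟩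
      - (suc m · 1#) * (n · 1#)    ∎
    mul -[1+ m ] -[1+ n ] = begin
      (suc m ℕ.* suc n) · 1#             ≈⟨ ×1-homo-* (suc m) (suc n) ⟩
      suc m · 1# * (suc n · 1#)          ≈⟨ -‿involutive _ ⟨
      - - (suc m · 1# * (suc n · 1#))    ≈⟨ -‿cong (-‿distribʳ-* _ _) ⟩
      - (suc m · 1# * - (suc n · 1#))    ≈⟨ -‿distribˡ-* _ _ ⟩
      - (suc m · 1#) * - (suc n · 1#)    ∎

    almost : AlmostCommutativeRing 0ℓ 0ℓ
    almost = fromCommutativeRing R

    morphism : ℤ.+-*-rawRing -Raw-AlmostCommutative⟶ almost
    morphism = record
      { ⟦_⟧ = ⟦_⟧ℤ ; +-homo = add ; *-homo = mul ; -‿homo = neg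
      ; 0-homo = refl ; 1-homo = refl }

  open import Algebra.Solver.Ring ℤ.+-*-rawRing almost morphism
    (λ i j → map (λ eq → reflexive (≡.cong ⟦_⟧ℤ eq)) (dec⇒maybe (i ℤ.≟ j))) public
    using (solve; con; _:+_; _:*_; _:-_; :-_; _:=_)

-- Linear algebra over a finite field

module LinearAlgebra {q : ℕ} (F : FiniteField q) where
  open FiniteField F hiding (zero)
  open Matrices F
  open IntegerCoefficients commRing public
  open import Algebra.Properties.Semiring.Sum semiring using (sum; sum-replicate-zero; ∑-distrib-+; ∑-comm; *-distribˡ-sum; *-distribʳ-sum)
  open import Algebra.Properties.Ring ring using (-0#≈0#)
  open import Relation.Binary.Reasoning.Setoid setoid

  index : Carrier → Fin q
  index x = proj₁ (enum-surjective x)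

  enum-index : ∀ x → enum (index x) ≈ x
  enum-index x = proj₂ (enum-surjective x)

  infix 4 _≈?_
  -- The enumeration makes the abstract field equality decidable; every case split on a vanishing
  -- entry rests on this.
  _≈?_ : ∀ x y → Dec (x ≈ y)
  x ≈? y = map′ (λ eq → trans (sym (enum-index x)) (trans (reflexive (≡.cong enum eq)) (enum-index y)))
    (λ eq → enum-injective _ _ (trans (enum-index x) (trans eq (sym (enum-index y)))))
    (index x Fin.≟ index y)

  *-cancel-0 : ∀ {x y} → ¬ (x ≈ 0#) → x * y ≈ 0# → y ≈ 0#
  *-cancel-0 {x} {y} x≉0 xy≈0 with inverse x x≉0
  ... | z , xz≈1 = begin
    y             ≈⟨ *-identityˡ y ⟨
    1# * y        ≈⟨ *-congʳ xz≈1 ⟨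
    (x * z) * y   ≈⟨ solve 3 (λ x y z → (x :* z) :* y := z :* (x :* y)) refl x y z ⟩
    z * (x * y)   ≈⟨ *-congˡ xy≈0 ⟩
    z * 0#        ≈⟨ zeroʳ z ⟩
    0#            ∎

  -‿≈0 : ∀ {x} → - x ≈ 0# → x ≈ 0#
  -‿≈0 {x} e = trans (solve 1 (λ x → x := :- (:- x)) refl x) (trans (-‿cong e) -0#≈0#)

  x-y≈0⇒x≈y : ∀ {x y} → x - y ≈ 0# → x ≈ y
  x-y≈0⇒x≈y {x} {y} e = trans (solve 2 (λ x y → x := (x :- y) :+ y) refl x y) (trans (+-congʳ e) (+-identityˡ y))

  ∑≡sum : ∀ n (f : Fin n → Carrier) → ∑ n f ≡ sum f
  ∑≡sum zero    f = ≡.refl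
  ∑≡sum (suc n) f = ≡.cong (λ x → f zero + x) (∑≡sum n (f ∘ suc))

  ∑-cong : ∀ n {f g : Fin n → Carrier} → (∀ i → f i ≈ g i) → ∑ n f ≈ ∑ n g
  ∑-cong zero    e = refl
  ∑-cong (suc n) e = +-cong (e zero) (∑-cong n (e ∘ suc))

  ∑-0 : ∀ n → ∑ n (λ _ → 0#) ≈ 0#
  ∑-0 n = trans (reflexive (∑≡sum n _)) (sum-replicate-zero n)

  ∑-+ : ∀ n (f g : Fin n → Carrier) → ∑ n (λ i → f i + g i) ≈ ∑ n f + ∑ n g
  ∑-+ n f g rewrite ∑≡sum n (λ i → f i + g i) | ∑≡sum n f | ∑≡sum n g = ∑-distrib-+ f g

  ∑-*ˡ : ∀ n c (f : Fin n → Carrier) → ∑ n (λ i → c * f i) ≈ c * ∑ n f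
  ∑-*ˡ n c f rewrite ∑≡sum n (λ i → c * f i) | ∑≡sum n f = sym (*-distribˡ-sum c f)

  ∑-*ʳ : ∀ n c (f : Fin n → Carrier) → ∑ n (λ i → f i * c) ≈ ∑ n f * c
  ∑-*ʳ n c f rewrite ∑≡sum n (λ i → f i * c) | ∑≡sum n f = sym (*-distribʳ-sum c f)

  ∑-swap : ∀ m n (f : Fin m → Fin n → Carrier) →
    ∑ m (λ i → ∑ n (f i)) ≈ ∑ n (λ j → ∑ m (λ i → f i j))
  ∑-swap m n f = begin
    ∑ m (λ i → ∑ n (f i))             ≈⟨ ∑-cong m (λ i → reflexive (∑≡sum n (f i))) ⟩
    ∑ m (λ i → sum (f i))             ≡⟨ ∑≡sum m _ ⟩
    sum (λ i → sum (f i))             ≈⟨ ∑-comm f ⟩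
    sum (λ j → sum (λ i → f i j))     ≡⟨ ∑≡sum n _ ⟨
    ∑ n (λ j → sum (λ i → f i j))     ≈⟨ ∑-cong n (λ j → reflexive (≡.sym (∑≡sum m _))) ⟩
    ∑ n (λ j → ∑ m (λ i → f i j))     ∎

  Vect : ℕ → Set
  Vect n = Fin n → Carrier

  infix 4 _≈V_
  _≈V_ : ∀ {n} → Vect n → Vect n → Set
  u ≈V v = ∀ i → u i ≈ v i

  NonZeroV : ∀ {n} → Vect n → Set
  NonZeroV u = ∃ λ i → ¬ (u i ≈ 0#)

  infixl 7 _∙_ _▹_ _◃_
  infixl 6 _+V_
  infixr 7 _⋆_

  _+V_ : ∀ {n} → Vect n → Vect n → Vect n
  (u +V v) i = u i + v i

  _⋆_ : ∀ {n} → Carrier → Vect n → Vect n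
  (c ⋆ u) i = c * u i

  _∙_ : ∀ {n} → Vect n → Vect n → Carrier
  _∙_ {n} φ u = ∑ n (λ r → φ r * u r)

  _▹_ : ∀ {n} → Mat n → Vect n → Vect n
  (M ▹ u) i = M i ∙ u

  _◃_ : ∀ {n} → Vect n → Mat n → Vect n
  (φ ◃ M) j = φ ∙ (λ r → M r j)

  ∙-cong : ∀ {n} {φ ψ u v : Vect n} → φ ≈V ψ → u ≈V v → φ ∙ u ≈ ψ ∙ v
  ∙-cong {n} e e′ = ∑-cong n (λ r → *-cong (e r) (e′ r))

  ∙-comm : ∀ {n} (φ u : Vect n) → φ ∙ u ≈ u ∙ φ
  ∙-comm {n} φ u = ∑-cong n (λ r → *-comm (φ r) (u r))

  ∙-+ʳ : ∀ {n} (φ u v : Vect n) → φ ∙ (u +V v) ≈ φ ∙ u + φ ∙ v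
  ∙-+ʳ {n} φ u v = trans (∑-cong n (λ r → distribˡ (φ r) (u r) (v r))) (∑-+ n _ _)

  ∙-⋆ʳ : ∀ {n} c (φ u : Vect n) → φ ∙ (c ⋆ u) ≈ c * (φ ∙ u)
  ∙-⋆ʳ {n} c φ u = trans (∑-cong n (λ r → solve 3 (λ c x y → x :* (c :* y) := c :* (x :* y)) refl c (φ r) (u r))) (∑-*ˡ n c _)

  ∙-+ˡ : ∀ {n} (φ ψ u : Vect n) → (φ +V ψ) ∙ u ≈ φ ∙ u + ψ ∙ u
  ∙-+ˡ φ ψ u = trans (∙-comm (φ +V ψ) u) (trans (∙-+ʳ u φ ψ) (+-cong (∙-comm u φ) (∙-comm u ψ)))

  ∙-⋆ˡ : ∀ {n} c (φ u : Vect n) → (c ⋆ φ) ∙ u ≈ c * (φ ∙ u)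
  ∙-⋆ˡ c φ u = trans (∙-comm (c ⋆ φ) u) (trans (∙-⋆ʳ c u φ) (*-congˡ (∙-comm u φ)))

  ◃-∙-▹ : ∀ {n} (φ : Vect n) (M : Mat n) (u : Vect n) → (φ ◃ M) ∙ u ≈ φ ∙ (M ▹ u)
  ◃-∙-▹ {n} φ M u = begin
    ∑ n (λ s → ∑ n (λ r → φ r * M r s) * u s)       ≈⟨ ∑-cong n (λ s → sym (∑-*ʳ n (u s) _)) ⟩
    ∑ n (λ s → ∑ n (λ r → φ r * M r s * u s))       ≈⟨ ∑-swap n n _ ⟩
    ∑ n (λ r → ∑ n (λ s → φ r * M r s * u s))       ≈⟨ ∑-cong n (λ r → ∑-cong n (λ s → *-assoc _ _ _)) ⟩
    ∑ n (λ r → ∑ n (λ s → φ r * (M r s * u s)))     ≈⟨ ∑-cong n (λ r → ∑-*ˡ n (φ r) _) ⟩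
    ∑ n (λ r → φ r * ∑ n (λ s → M r s * u s))       ∎

  -- Taking the rows of `I` makes `I ▹ u` and `e i ∙ u`, and later the rows of `I + u φ` and
  -- `e i +V u i ⋆ φ`, agree definitionally.
  e : ∀ {n} → Fin n → Vect n
  e = I

  e-diag : ∀ {n} (i : Fin n) → e i i ≈ 1#
  e-diag zero    = refl
  e-diag (suc i) = e-diag i

  e-off : ∀ {n} {i j : Fin n} → i ≢ j → e i j ≈ 0#
  e-off {i = zero}  {zero}  i≢j = ⊥-elim (i≢j ≡.refl)
  e-off {i = zero}  {suc j} i≢j = refl
  e-off {i = suc i} {zero}  i≢j = refl
  e-off {i = suc i} {suc j} i≢j = e-off (i≢j ∘ ≡.cong suc)

  e-sym : ∀ {n} (i j : Fin n) → e i j ≡ e j i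
  e-sym zero    zero    = ≡.refl
  e-sym zero    (suc j) = ≡.refl
  e-sym (suc i) zero    = ≡.refl
  e-sym (suc i) (suc j) = e-sym i j

  e-∙ : ∀ {n} (i : Fin n) (u : Vect n) → e i ∙ u ≈ u i
  e-∙ {suc n} zero u = begin
    1# * u zero + ∑ n (λ r → 0# * u (suc r))  ≈⟨ +-cong (*-identityˡ _) (trans (∑-cong n (λ r → zeroˡ _)) (∑-0 n)) ⟩
    u zero + 0#                               ≈⟨ +-identityʳ _ ⟩
    u zero                                    ∎
  e-∙ {suc n} (suc i) u = begin
    0# * u zero + e i ∙ (u ∘ suc)  ≈⟨ +-cong (zeroˡ _) (e-∙ i (u ∘ suc)) ⟩
    0# + u (suc i)                 ≈⟨ +-identityˡ _ ⟩
    u (suc i)                      ∎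

  ∙-e : ∀ {n} (i : Fin n) (u : Vect n) → u ∙ e i ≈ u i
  ∙-e i u = trans (∙-comm u (e i)) (e-∙ i u)

  I-▹ : ∀ {n} (u : Vect n) → I ▹ u ≈V u
  I-▹ u i = e-∙ i u

  ◃-I : ∀ {n} (φ : Vect n) → φ ◃ I ≈V φ
  ◃-I φ j = trans (∙-cong (λ _ → refl) (λ r → reflexive (e-sym r j))) (∙-e j φ)

  ▹-e : ∀ {n} (M : Mat n) j → M ▹ e j ≈V (λ i → M i j)
  ▹-e M j i = ∙-e j (M i)

  ≈M-refl : ∀ {n} {A : Mat n} → A ≈M A
  ≈M-refl i j = refl

  ≈M-sym : ∀ {n} {A B : Mat n} → A ≈M B → B ≈M A
  ≈M-sym eq i j = sym (eq i j)

  ≈M-trans : ∀ {n} {A B C : Mat n} → A ≈M B → B ≈M C → A ≈M C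
  ≈M-trans eq eq′ i j = trans (eq i j) (eq′ i j)

  *M-cong : ∀ {n} {A A′ B B′ : Mat n} → A ≈M A′ → B ≈M B′ → (A *M B) ≈M (A′ *M B′)
  *M-cong eq eq′ i j = ∙-cong (eq i) (λ r → eq′ r j)

  *M-assoc : ∀ {n} (A B C : Mat n) → ((A *M B) *M C) ≈M (A *M (B *M C))
  *M-assoc A B C i j = ◃-∙-▹ (A i) B (λ s → C s j)

  *M-monoid : ℕ → Monoid 0ℓ 0ℓ
  *M-monoid n = record
    { Carrier = Mat n ; _≈_ = _≈M_ ; _∙_ = _*M_ ; ε = I
    ; isMonoid = record
      { isSemigroup = record
        { isMagma = record
          { isEquivalence = record { refl = ≈M-refl ; sym = ≈M-sym ; trans = ≈M-trans }
          ; ∙-cong = *M-cong }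
        ; assoc = *M-assoc }
      ; identity = (λ A i j → e-∙ i (λ r → A r j)) , (λ A i j → ◃-I (A i) j) } }

  ▹-cong : ∀ {n} {M N : Mat n} {u v : Vect n} → M ≈M N → u ≈V v → M ▹ u ≈V N ▹ v
  ▹-cong eq eq′ i = ∙-cong (eq i) eq′

  ◃-cong : ∀ {n} {M N : Mat n} {φ ψ : Vect n} → φ ≈V ψ → M ≈M N → φ ◃ M ≈V ψ ◃ N
  ◃-cong eq eq′ j = ∙-cong eq (λ r → eq′ r j)

  *M-▹ : ∀ {n} (M N : Mat n) u → (M *M N) ▹ u ≈V M ▹ (N ▹ u)
  *M-▹ M N u i = ◃-∙-▹ (M i) N u

  ◃-*M : ∀ {n} φ (M N : Mat n) → φ ◃ (M *M N) ≈V (φ ◃ M) ◃ N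
  ◃-*M φ M N j = sym (◃-∙-▹ φ M (λ r → N r j))

  ◃-⋆ : ∀ {n} c φ (M : Mat n) → (c ⋆ φ) ◃ M ≈V c ⋆ (φ ◃ M)
  ◃-⋆ c φ M j = ∙-⋆ˡ c φ (λ r → M r j)

  ▹-⋆ : ∀ {n} (M : Mat n) c u → M ▹ (c ⋆ u) ≈V c ⋆ (M ▹ u)
  ▹-⋆ M c u i = ∙-⋆ʳ c (M i) u

  *M-distribˡ : ∀ {n} (A B C : Mat n) → (A *M (B +M C)) ≈M ((A *M B) +M (A *M C))
  *M-distribˡ A B C i j = ∙-+ʳ (A i) (λ r → B r j) (λ r → C r j)

  *M-distribʳ : ∀ {n} (A B C : Mat n) → ((B +M C) *M A) ≈M ((B *M A) +M (C *M A))
  *M-distribʳ A B C i j = ∙-+ˡ (B i) (C i) (λ r → A r j)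

  _ᵀ : ∀ {n} → Mat n → Mat n
  (A ᵀ) i j = A j i

  *M-ᵀ : ∀ {n} (A B : Mat n) → ((A *M B) ᵀ) ≈M ((B ᵀ) *M (A ᵀ))
  *M-ᵀ A B i j = ∙-comm (A j) (λ r → B r i)

-- Transvections: inverses, commutators and conjugacy

module Transvections {q : ℕ} (F : FiniteField q) where
  open FiniteField F hiding (zero)
  open Matrices F
  open LinearAlgebra F
  open import Algebra.Properties.Ring ring using (-0#≈0#)
  open import Relation.Binary.Reasoning.Setoid setoid

  ≉V⇒∃≉ : ∀ {n} {u v : Vect n} → ¬ (u ≈V v) → ∃ λ i → ¬ (u i ≈ v i)
  ≉V⇒∃≉ {n} {u} {v} = Fin.¬∀⟶∃¬ n _ (λ i → u i ≈? v i)

  -- The matrix `I + u φ`, with no condition on `φ ∙ u`: besides transvections it also supplies the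
  -- dilations and the changes of basis that conjugate one transvection into another.
  T : ∀ {n} → Vect n → Vect n → Mat n
  T u φ i j = I i j + u i * φ j

  T-cong : ∀ {n} {u v φ ψ : Vect n} → u ≈V v → φ ≈V ψ → T u φ ≈M T v ψ
  T-cong eq eq′ i j = +-congˡ (*-cong (eq i) (eq′ j))

  T-0 : ∀ {n} {u : Vect n} φ → (∀ i → u i ≈ 0#) → T u φ ≈M I
  T-0 φ u≈0 i j = trans (+-congˡ (trans (*-congʳ (u≈0 i)) (zeroˡ _))) (+-identityʳ _)

  T-▹ : ∀ {n} (u φ v : Vect n) → T u φ ▹ v ≈V v +V (φ ∙ v) ⋆ u
  T-▹ u φ v i = begin
    (e i +V u i ⋆ φ) ∙ v       ≈⟨ ∙-+ˡ (e i) (u i ⋆ φ) v ⟩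
    e i ∙ v + (u i ⋆ φ) ∙ v    ≈⟨ +-cong (e-∙ i v) (trans (∙-⋆ˡ (u i) φ v) (*-comm _ _)) ⟩
    v i + (φ ∙ v) * u i        ∎

  ◃-T : ∀ {n} (ψ u φ : Vect n) → ψ ◃ T u φ ≈V ψ +V (ψ ∙ u) ⋆ φ
  ◃-T ψ u φ j = begin
    ψ ∙ (λ r → I r j + u r * φ j)           ≈⟨ ∙-+ʳ ψ (λ r → I r j) (λ r → u r * φ j) ⟩
    (ψ ◃ I) j + ψ ∙ (λ r → u r * φ j)       ≈⟨ +-cong (◃-I ψ j) (∙-cong {φ = ψ} (λ _ → refl) (λ r → *-comm (u r) (φ j))) ⟩
    ψ j + ψ ∙ (φ j ⋆ u)                     ≈⟨ +-congˡ (trans (∙-⋆ʳ (φ j) ψ u) (*-comm _ _)) ⟩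
    ψ j + (ψ ∙ u) * φ j                     ∎

  T-*M-T : ∀ {n} (u v φ : Vect n) → (T u φ *M T v φ) ≈M T ((u +V v) +V (φ ∙ v) ⋆ u) φ
  T-*M-T u v φ i j = begin
    (T u φ i ◃ T v φ) j                         ≈⟨ ◃-T (T u φ i) v φ j ⟩
    T u φ i j + (T u φ ▹ v) i * φ j             ≈⟨ +-congˡ (*-congʳ (T-▹ u φ v i)) ⟩
    I i j + u i * φ j + (v i + φ ∙ v * u i) * φ j
      ≈⟨ solve 5 (λ x u v f d → x :+ u :* f :+ (v :+ d :* u) :* f := x :+ (u :+ v :+ d :* u) :* f) refl (I i j) (u i) (v i) (φ j) (φ ∙ v) ⟩
    I i j + (u i + v i + φ ∙ v * u i) * φ j     ∎

  -- Reduces the conjugacy of transvections to moving a vector and a functional.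
  T-conj : ∀ {n} (h h′ : Mat n) (u φ : Vect n) → (h *M h′) ≈M I →
    ((h *M T u φ) *M h′) ≈M T (h ▹ u) (φ ◃ h′)
  T-conj h h′ u φ hh′≈I i j = begin
    ((h i ◃ T u φ) ◃ h′) j                          ≈⟨ ◃-cong {M = h′} (◃-T (h i) u φ) ≈M-refl j ⟩
    ((h i +V (h i ∙ u) ⋆ φ) ◃ h′) j                 ≈⟨ ∙-+ˡ (h i) ((h i ∙ u) ⋆ φ) (λ r → h′ r j) ⟩
    (h *M h′) i j + (((h i ∙ u) ⋆ φ) ◃ h′) j        ≈⟨ +-cong (hh′≈I i j) (◃-⋆ (h i ∙ u) φ h′ j) ⟩
    I i j + (h ▹ u) i * (φ ◃ h′) j                  ∎

  -- Sherman-Morrison with the division multiplied out: `c` plays the role of `-1 / (1 + φ u)`,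
  -- which is -1 for a transvection.
  T-inverse : ∀ {n} (u φ : Vect n) c → c + φ ∙ u * c ≈ - 1# →
    ((T u φ *M T (c ⋆ u) φ) ≈M I) × ((T (c ⋆ u) φ *M T u φ) ≈M I)
  T-inverse u φ c eq =
      ≈M-trans (T-*M-T u (c ⋆ u) φ) (T-0 φ λ i → begin
        u i + c * u i + φ ∙ (c ⋆ u) * u i       ≈⟨ +-congˡ (*-congʳ (∙-⋆ʳ c φ u)) ⟩
        u i + c * u i + c * (φ ∙ u) * u i       ≈⟨ solve 3 (λ u c d → u :+ c :* u :+ c :* d :* u := (con (+ 1) :+ (c :+ d :* c)) :* u) refl (u i) c (φ ∙ u) ⟩
        (1# + (c + φ ∙ u * c)) * u i            ≈⟨ *-congʳ (trans (+-congˡ eq) (-‿inverseʳ 1#)) ⟩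
        0# * u i                                ≈⟨ zeroˡ _ ⟩
        0#                                      ∎)
    , ≈M-trans (T-*M-T (c ⋆ u) u φ) (T-0 φ λ i → begin
        c * u i + u i + φ ∙ u * (c * u i)       ≈⟨ solve 3 (λ u c d → c :* u :+ u :+ d :* (c :* u) := (con (+ 1) :+ (c :+ d :* c)) :* u) refl (u i) c (φ ∙ u) ⟩
        (1# + (c + φ ∙ u * c)) * u i            ≈⟨ *-congʳ (trans (+-congˡ eq) (-‿inverseʳ 1#)) ⟩
        0# * u i                                ≈⟨ zeroˡ _ ⟩
        0#                                      ∎)

  T-InGL : ∀ {n} (u φ : Vect n) → ¬ (1# + φ ∙ u ≈ 0#) → InGL (T u φ)
  T-InGL u φ ne with inverse _ ne
  ... | y , eq = T (- y ⋆ u) φ , T-inverse u φ (- y) (begin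
    - y + φ ∙ u * - y     ≈⟨ solve 2 (λ y d → :- y :+ d :* :- y := :- ((con (+ 1) :+ d) :* y)) refl y (φ ∙ u) ⟩
    - ((1# + φ ∙ u) * y)  ≈⟨ -‿cong eq ⟩
    - 1#                  ∎)

  transvection-inverse : ∀ {n} (u φ : Vect n) → φ ∙ u ≈ 0# →
    ((T u φ *M T (- 1# ⋆ u) φ) ≈M I) × ((T (- 1# ⋆ u) φ *M T u φ) ≈M I)
  transvection-inverse u φ φu≈0 = T-inverse u φ (- 1#) (trans (+-congˡ (trans (*-congʳ φu≈0) (zeroˡ _))) (+-identityʳ _))

  record NormalSubgroup {n} (H : Mat n → Set) : Set where
    field
      resp : ∀ {a b} → a ≈M b → H a → H b
      mul  : ∀ {a b} → H a → H b → H (a *M b)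
      inv  : ∀ {a} → H a → ∃ λ a′ → ((a *M a′) ≈M I) × ((a′ *M a) ≈M I) × H a′
      conj : ∀ {a c c′} → (c *M c′) ≈M I → (c′ *M c) ≈M I → H a → H ((c *M a) *M c′)

  record Transvection {n} (u φ : Vect n) : Set where
    constructor transvection
    field
      φu≈0 : φ ∙ u ≈ 0#
      u≉0  : NonZeroV u
      φ≉0  : NonZeroV φ

  ◃-cancel : ∀ {n} φ (h h′ : Mat n) → (h *M h′) ≈M I → (φ ◃ h) ◃ h′ ≈V φ
  ◃-cancel φ h h′ eq j = trans (sym (◃-*M φ h h′ j)) (trans (◃-cong {φ = φ} (λ _ → refl) eq j) (◃-I φ j))

  ▹-cancel : ∀ {n} u (h h′ : Mat n) → (h *M h′) ≈M I → h ▹ (h′ ▹ u) ≈V u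
  ▹-cancel u h h′ eq i = trans (sym (*M-▹ h h′ u i)) (trans (▹-cong {u = u} eq (λ _ → refl) i) (I-▹ u i))

  module _ {n} {H : Mat n → Set} (N : NormalSubgroup H) where
    open NormalSubgroup N
    private module M = Monoid (*M-monoid n)
    open import Relation.Binary.Reasoning.Setoid M.setoid as MR using ()

    -- The commutator of h with T u φ is T (h u - b u) (φ h⁻¹), because φ = b (φ h⁻¹).
    eigenvector⇒transvection : ∀ {h φ u} b → H h → φ ◃ h ≈V b ⋆ φ → NonZeroV φ → φ ∙ u ≈ 0# →
      ¬ (h ▹ u ≈V b ⋆ u) → ∃ λ w → ∃ λ ψ → Transvection w ψ × H (T w ψ)
    eigenvector⇒transvection {h} {φ} {u} b Hh φh≈bφ (s , φs≉0) φu≈0 hu≉bu = w , ψ , transvection ψw≈0 w≉0 ψ≉0 , resp eq (mul Hh (conj (proj₁ tt′) (proj₂ tt′) Hh′))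
      where
      h′ : Mat n
      h′ = proj₁ (inv Hh)
      hh′ : (h *M h′) ≈M I
      hh′ = proj₁ (proj₂ (inv Hh))
      h′h : (h′ *M h) ≈M I
      h′h = proj₁ (proj₂ (proj₂ (inv Hh)))
      Hh′ : H h′
      Hh′ = proj₂ (proj₂ (proj₂ (inv Hh)))
      ψ w : Vect n
      ψ = φ ◃ h′
      w = h ▹ u +V - b ⋆ u
      tt′ = transvection-inverse u φ φu≈0
      bψ≈φ : b ⋆ ψ ≈V φ
      bψ≈φ j = begin
        b * (φ ◃ h′) j         ≈⟨ ◃-⋆ b φ h′ j ⟨
        ((b ⋆ φ) ◃ h′) j       ≈⟨ ◃-cong {M = h′} φh≈bφ ≈M-refl j ⟨
        ((φ ◃ h) ◃ h′) j       ≈⟨ ◃-cancel φ h h′ hh′ j ⟩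
        φ j                    ∎
      ψbu : ψ ∙ (- b ⋆ u) ≈ 0#
      ψbu = begin
        ψ ∙ (- b ⋆ u)          ≈⟨ ∙-⋆ʳ (- b) ψ u ⟩
        - b * (ψ ∙ u)          ≈⟨ solve 2 (λ b x → :- b :* x := :- (b :* x)) refl b (ψ ∙ u) ⟩
        - (b * (ψ ∙ u))        ≈⟨ -‿cong (∙-⋆ˡ b ψ u) ⟨
        - ((b ⋆ ψ) ∙ u)        ≈⟨ -‿cong (∙-cong {u = u} bψ≈φ (λ _ → refl)) ⟩
        - (φ ∙ u)              ≈⟨ -‿cong φu≈0 ⟩
        - 0#                   ≈⟨ -0#≈0# ⟩
        0#                     ∎
      ψw≈0 : ψ ∙ w ≈ 0#
      ψw≈0 = begin
        ψ ∙ (h ▹ u +V - b ⋆ u)          ≈⟨ ∙-+ʳ ψ (h ▹ u) (- b ⋆ u) ⟩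
        ψ ∙ (h ▹ u) + ψ ∙ (- b ⋆ u)     ≈⟨ +-cong (sym (◃-∙-▹ ψ h u)) ψbu ⟩
        (ψ ◃ h) ∙ u + 0#                ≈⟨ +-identityʳ _ ⟩
        (ψ ◃ h) ∙ u                     ≈⟨ ∙-cong {u = u} (◃-cancel φ h′ h h′h) (λ _ → refl) ⟩
        φ ∙ u                           ≈⟨ φu≈0 ⟩
        0#                              ∎
      ψ≉0 : NonZeroV ψ
      ψ≉0 = s , λ ψs≈0 → φs≉0 (trans (sym (bψ≈φ s)) (trans (*-congˡ ψs≈0) (zeroʳ b)))
      w≉0 : NonZeroV w
      w≉0 with ≉V⇒∃≉ hu≉bu
      ... | i , ne = i , λ wi≈0 → ne (x-y≈0⇒x≈y (trans (solve 3 (λ x b u → x :- b :* u := x :+ :- b :* u) refl ((h ▹ u) i) b (u i)) wi≈0))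
      t t′ : Mat n
      t = T u φ
      t′ = T (- 1# ⋆ u) φ
      t′≈ : t′ ≈M T (- b ⋆ u) ψ
      t′≈ i j = +-congˡ (begin
        - 1# * u i * φ j             ≈⟨ *-congˡ (bψ≈φ j) ⟨
        - 1# * u i * (b * ψ j)       ≈⟨ solve 3 (λ u b p → :- con (+ 1) :* u :* (b :* p) := :- b :* u :* p) refl (u i) b (ψ j) ⟩
        - b * u i * ψ j              ∎)
      eq : (h *M ((t *M h′) *M t′)) ≈M T w ψ
      eq = MR.begin
        h *M ((t *M h′) *M t′)            MR.≈⟨ M.assoc h (t *M h′) t′ ⟨
        (h *M (t *M h′)) *M t′            MR.≈⟨ *M-cong (≈M-sym (M.assoc h t h′)) t′≈ ⟩
        ((h *M t) *M h′) *M T (- b ⋆ u) ψ MR.≈⟨ *M-cong (T-conj h h′ u φ hh′) ≈M-refl ⟩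
        T (h ▹ u) ψ *M T (- b ⋆ u) ψ      MR.≈⟨ T-*M-T (h ▹ u) (- b ⋆ u) ψ ⟩
        T (w +V (ψ ∙ (- b ⋆ u)) ⋆ (h ▹ u)) ψ
          MR.≈⟨ T-cong {φ = ψ} (λ i → trans (+-congˡ (trans (*-congʳ ψbu) (zeroˡ _))) (+-identityʳ _)) (λ _ → refl) ⟩
        T w ψ                             MR.∎

  -- Two hyperplanes never cover the space, even over two elements. If coordinate `i` or coordinate
  -- `j` is nonzero on both vectors, it serves after scaling; otherwise each of the two sees only
  -- one of the vectors, and their combination sees both.
  common-functional : ∀ {n} {u v : Vect n} → NonZeroV u → NonZeroV v →
    ∃ λ θ → (θ ∙ u ≈ 1#) × ¬ (θ ∙ v ≈ 0#)
  common-functional {n} {u} {v} (i , ui≉0) (j , vj≉0) with inverse (u i) ui≉0 | v i ≈? 0# | u j ≈? 0#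
  ... | y , uy≈1 | no vi≉0 | _ = y ⋆ e i
    , trans (val u) (trans (*-comm _ _) uy≈1)
    , λ eq → vi≉0 (*-cancel-0 (λ y≈0 → 1≉0 (trans (sym uy≈1) (trans (*-congˡ y≈0) (zeroʳ _)))) (trans (sym (val v)) eq))
    where
    val : ∀ w → (y ⋆ e i) ∙ w ≈ y * w i
    val w = trans (∙-⋆ˡ y (e i) w) (*-congˡ (e-∙ i w))
  ... | y , uy≈1 | yes vi≈0 | no uj≉0 with inverse (u j) uj≉0
  ...   | z , uz≈1 = z ⋆ e j
    , trans (val u) (trans (*-comm _ _) uz≈1)
    , λ eq → vj≉0 (*-cancel-0 (λ z≈0 → 1≉0 (trans (sym uz≈1) (trans (*-congˡ z≈0) (zeroʳ _)))) (trans (sym (val v)) eq))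
    where
    val : ∀ w → (z ⋆ e j) ∙ w ≈ z * w j
    val w = trans (∙-⋆ˡ z (e j) w) (*-congˡ (e-∙ j w))
  common-functional {n} {u} {v} (i , ui≉0) (j , vj≉0) | y , uy≈1 | yes vi≈0 | yes uj≈0 = y ⋆ e i +V e j
    , (begin
        (y ⋆ e i +V e j) ∙ u  ≈⟨ val u ⟩
        y * u i + u j         ≈⟨ +-cong (trans (*-comm _ _) uy≈1) uj≈0 ⟩
        1# + 0#               ≈⟨ +-identityʳ _ ⟩
        1#                    ∎)
    , λ eq → vj≉0 (begin
        v j                   ≈⟨ +-identityˡ _ ⟨
        0# + v j              ≈⟨ +-congʳ (trans (*-congˡ vi≈0) (zeroʳ y)) ⟨
        y * v i + v j         ≈⟨ val v ⟨
        (y ⋆ e i +V e j) ∙ v  ≈⟨ eq ⟩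
        0#                    ∎)
    where
    val : ∀ w → (y ⋆ e i +V e j) ∙ w ≈ y * w i + w j
    val w = trans (∙-+ˡ (y ⋆ e i) (e j) w) (+-cong (trans (∙-⋆ˡ y (e i) w) (*-congˡ (e-∙ i w))) (e-∙ j w))

  ◃-NonZeroV : ∀ {n} {φ : Vect n} (c c′ : Mat n) → (c′ *M c) ≈M I → NonZeroV φ → NonZeroV (φ ◃ c′)
  ◃-NonZeroV {n} {φ} c c′ c′c (s , φs≉0) = ≉V⇒∃≉ λ all0 → φs≉0 (begin
    φ s                     ≈⟨ ◃-cancel φ c′ c c′c s ⟨
    ((φ ◃ c′) ◃ c) s        ≈⟨ ∙-cong {u = λ r → c r s} all0 (λ _ → refl) ⟩
    (λ _ → 0#) ∙ (λ r → c r s)      ≈⟨ trans (∑-cong n (λ r → zeroˡ (c r s))) (∑-0 n) ⟩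
    0#                      ∎)

  -- Since `θ` is 1 on `u`, the matrix `I + (v - u) θ` adds `v - u` to `u`; the number
  -- `1 + θ (v - u)` that decides its invertibility collapses to `θ v`. Nonzero vectors are thus
  -- moved to each other without completing bases.
  reflection-vector : ∀ {n} (u v θ : Vect n) → θ ∙ u ≈ 1# → ¬ (θ ∙ v ≈ 0#) →
    InGL (T (v +V - 1# ⋆ u) θ) × (T (v +V - 1# ⋆ u) θ ▹ u ≈V v)
  reflection-vector u v θ θu≈1 θv≉0 = T-InGL w θ (λ eq → θv≉0 (trans (sym step) eq)) , moves
    where
    w : Vect _
    w = v +V - 1# ⋆ u
    step : 1# + θ ∙ w ≈ θ ∙ v
    step = begin
      1# + θ ∙ w                          ≈⟨ +-congˡ (trans (∙-+ʳ θ v (- 1# ⋆ u)) (+-congˡ (trans (∙-⋆ʳ (- 1#) θ u) (*-congˡ θu≈1)))) ⟩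
      1# + (θ ∙ v + - 1# * 1#)            ≈⟨ solve 1 (λ x → con (+ 1) :+ (x :+ :- con (+ 1) :* con (+ 1)) := x) refl (θ ∙ v) ⟩
      θ ∙ v                               ∎
    moves : T w θ ▹ u ≈V v
    moves i = begin
      (T w θ ▹ u) i                           ≈⟨ T-▹ w θ u i ⟩
      u i + θ ∙ u * (v i + - 1# * u i)        ≈⟨ +-congˡ (*-congʳ θu≈1) ⟩
      u i + 1# * (v i + - 1# * u i)           ≈⟨ solve 2 (λ u v → u :+ con (+ 1) :* (v :+ :- con (+ 1) :* u) := v) refl (u i) (v i) ⟩
      v i                                     ∎

  reflection-functional : ∀ {n} (φ ψ x : Vect n) → x ∙ φ ≈ 1# → ¬ (x ∙ ψ ≈ 0#) →
    InGL (T x (ψ +V - 1# ⋆ φ)) × (φ ◃ T x (ψ +V - 1# ⋆ φ) ≈V ψ)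
  reflection-functional φ ψ x xφ≈1 xψ≉0 = T-InGL x χ (λ eq → xψ≉0 (trans (sym step) eq)) , moves
    where
    χ : Vect _
    χ = ψ +V - 1# ⋆ φ
    step : 1# + χ ∙ x ≈ x ∙ ψ
    step = begin
      1# + χ ∙ x                          ≈⟨ +-congˡ (∙-comm χ x) ⟩
      1# + x ∙ χ                          ≈⟨ +-congˡ (trans (∙-+ʳ x ψ (- 1# ⋆ φ)) (+-congˡ (trans (∙-⋆ʳ (- 1#) x φ) (*-congˡ xφ≈1)))) ⟩
      1# + (x ∙ ψ + - 1# * 1#)            ≈⟨ solve 1 (λ x → con (+ 1) :+ (x :+ :- con (+ 1) :* con (+ 1)) := x) refl (x ∙ ψ) ⟩
      x ∙ ψ                               ∎
    moves : φ ◃ T x χ ≈V ψ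
    moves j = begin
      (φ ◃ T x χ) j                   ≈⟨ ◃-T φ x χ j ⟩
      φ j + φ ∙ x * χ j               ≈⟨ +-congˡ (*-congʳ (trans (∙-comm φ x) xφ≈1)) ⟩
      φ j + 1# * (ψ j + - 1# * φ j)   ≈⟨ solve 2 (λ u v → u :+ con (+ 1) :* (v :+ :- con (+ 1) :* u) := v) refl (φ j) (ψ j) ⟩
      ψ j                             ∎

  module _ {n} {H : Mat n → Set} (N : NormalSubgroup H) where
    open NormalSubgroup N

    -- The functional is dragged along to an uncontrolled `ψ`, which `move-functional` corrects
    -- afterwards.
    move-vector : ∀ {u φ v} → Transvection u φ → H (T u φ) → NonZeroV v →
      ∃ λ ψ → Transvection v ψ × H (T v ψ)
    move-vector {u} {φ} {v} (transvection φu≈0 u≉0 φ≉0) HT v≉0 = go (common-functional u≉0 v≉0)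
      where
      conjugate : ∀ {c} → InGL c → c ▹ u ≈V v → ∃ λ ψ → Transvection v ψ × H (T v ψ)
      conjugate {c} (c′ , cc′ , c′c) cu≈v = φ ◃ c′ , transvection ψv≈0 v≉0 (◃-NonZeroV c c′ c′c φ≉0)
        , resp (≈M-trans (T-conj c c′ u φ cc′) (T-cong {φ = φ ◃ c′} cu≈v (λ _ → refl))) (conj cc′ c′c HT)
        where
        ψv≈0 : (φ ◃ c′) ∙ v ≈ 0#
        ψv≈0 = begin
          (φ ◃ c′) ∙ v          ≈⟨ ∙-cong {φ = φ ◃ c′} (λ _ → refl) cu≈v ⟨
          (φ ◃ c′) ∙ (c ▹ u)    ≈⟨ ◃-∙-▹ (φ ◃ c′) c u ⟨
          ((φ ◃ c′) ◃ c) ∙ u    ≈⟨ ∙-cong {u = u} (◃-cancel φ c′ c c′c) (λ _ → refl) ⟩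
          φ ∙ u                 ≈⟨ φu≈0 ⟩
          0#                    ∎
      go : (∃ λ θ → (θ ∙ u ≈ 1#) × ¬ (θ ∙ v ≈ 0#)) → ∃ λ ψ → Transvection v ψ × H (T v ψ)
      go (θ , θu≈1 , θv≉0) = conjugate (proj₁ r) (proj₂ r)
        where r = reflection-vector u v θ θu≈1 θv≉0

    -- Both functionals kill `v`, so `I + x (ψ - φ)` fixes `v`; conjugating by its inverse changes
    -- the functional and leaves the vector.
    move-functional : ∀ {v φ ψ} → Transvection v φ → H (T v φ) → Transvection v ψ → H (T v ψ)
    move-functional {v} {φ} {ψ} (transvection φv≈0 _ φ≉0) HT (transvection ψv≈0 _ ψ≉0) = go (common-functional φ≉0 ψ≉0)
      where
      χ : Vect n
      χ = ψ +V - 1# ⋆ φ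
      χv≈0 : χ ∙ v ≈ 0#
      χv≈0 = begin
        χ ∙ v                       ≈⟨ ∙-+ˡ ψ (- 1# ⋆ φ) v ⟩
        ψ ∙ v + (- 1# ⋆ φ) ∙ v      ≈⟨ +-cong ψv≈0 (trans (∙-⋆ˡ (- 1#) φ v) (*-congˡ φv≈0)) ⟩
        0# + - 1# * 0#              ≈⟨ trans (+-identityˡ _) (zeroʳ _) ⟩
        0#                          ∎
      conjugate : ∀ {c} → InGL c → c ▹ v ≈V v → φ ◃ c ≈V ψ → H (T v ψ)
      conjugate {c} (c′ , cc′ , c′c) cv≈v φc≈ψ =
        resp (≈M-trans (T-conj c′ c v φ c′c) (T-cong c′v≈v φc≈ψ)) (conj c′c cc′ HT)
        where
        c′v≈v : c′ ▹ v ≈V v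
        c′v≈v i = trans (▹-cong {M = c′} ≈M-refl (λ r → sym (cv≈v r)) i) (▹-cancel v c′ c c′c i)
      go : (∃ λ x → (x ∙ φ ≈ 1#) × ¬ (x ∙ ψ ≈ 0#)) → H (T v ψ)
      go (x , xφ≈1 , xψ≉0) = conjugate (proj₁ r)
        (λ i → trans (T-▹ x χ v i) (trans (+-congˡ (trans (*-congʳ χv≈0) (zeroˡ _))) (+-identityʳ _))) (proj₂ r)
        where r = reflection-functional φ ψ x xφ≈1 xψ≉0

    all-transvections : ∀ {u φ v ψ} → Transvection u φ → H (T u φ) → Transvection v ψ → H (T v ψ)
    all-transvections tu HT tv =
      let (φ′ , tv′ , HT′) = move-vector tu HT (Transvection.u≉0 tv) in move-functional tv′ HT′ tv

-- Conjugation in a monoid, and a pigeonhole lemma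

module Conjugation (M : Monoid 0ℓ 0ℓ) where
  open Monoid M
  open import Algebra.Properties.Monoid M using (cancelˡ; cancelʳ)
  open import Relation.Binary.Reasoning.Setoid setoid

  conj-∙ : ∀ {c c′} → c′ ∙ c ≈ ε → ∀ a b → (c ∙ a ∙ c′) ∙ (c ∙ b ∙ c′) ≈ c ∙ (a ∙ b) ∙ c′
  conj-∙ {c} {c′} c′c a b = begin
    (c ∙ a ∙ c′) ∙ (c ∙ b ∙ c′)    ≈⟨ assoc (c ∙ a) c′ _ ⟩
    (c ∙ a) ∙ (c′ ∙ (c ∙ b ∙ c′))  ≈⟨ ∙-congˡ (trans (∙-congˡ (assoc c b c′)) (cancelˡ c′c _)) ⟩
    (c ∙ a) ∙ (b ∙ c′)             ≈⟨ assoc (c ∙ a) b c′ ⟨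
    c ∙ a ∙ b ∙ c′                 ≈⟨ ∙-congʳ (assoc c a b) ⟩
    c ∙ (a ∙ b) ∙ c′               ∎

  conj-conj : ∀ {c c′} → c ∙ c′ ≈ ε → ∀ t → c ∙ (c′ ∙ t ∙ c) ∙ c′ ≈ t
  conj-conj {c} {c′} cc′ t = begin
    c ∙ (c′ ∙ t ∙ c) ∙ c′    ≈⟨ ∙-congʳ (trans (∙-congˡ (assoc c′ t c)) (cancelˡ cc′ _)) ⟩
    t ∙ c ∙ c′               ≈⟨ cancelʳ cc′ t ⟩
    t                        ∎

  conj-ε : ∀ {c c′} → c ∙ c′ ≈ ε → c ∙ ε ∙ c′ ≈ ε
  conj-ε cc′ = trans (∙-congʳ (identityʳ _)) cc′

-- If every value were hit, a choice of preimages would map the larger set into the smaller one, and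
-- a collision there would identify two distinct values. It supplies a third index and a field
-- element outside a short list.
missed-value : ∀ {m n} → m ℕ.< n → (f : Fin m → Fin n) → ∃ λ j → ∀ i → f i ≢ j
missed-value {m} {n} m<n f with Fin.any? (λ j → Fin.all? (λ i → ¬? (f i Fin.≟ j)))
... | yes p = p
... | no ¬p = ⊥-elim (Fin.<⇒≢ i<j (≡.trans (≡.sym (proj₂ (preimage i))) (≡.trans (≡.cong f gi≡gj) (proj₂ (preimage j)))))
  where
  preimage : ∀ j → ∃ λ i → f i ≡ j
  preimage j with Fin.any? (λ i → f i Fin.≟ j)
  ... | yes q = q
  ... | no ¬q = ⊥-elim (¬p (j , λ i eq → ¬q (i , eq)))
  collision = Fin.pigeonhole m<n (proj₁ ∘ preimage)
  i = proj₁ collision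
  j = proj₁ (proj₂ collision)
  i<j = proj₁ (proj₂ (proj₂ collision))
  gi≡gj = proj₂ (proj₂ (proj₂ collision))

-- Normal subgroups of GL_n that contain a non-scalar matrix

module NormalSubgroups {q : ℕ} (F : FiniteField q) where
  open FiniteField F hiding (zero)
  open Matrices F
  open LinearAlgebra F
  open Transvections F
  open import Relation.Binary.Reasoning.Setoid setoid

  ◃-T-fixed : ∀ {n} (φ u ψ : Vect n) → φ ∙ u ≈ 0# → φ ◃ T u ψ ≈V φ
  ◃-T-fixed φ u ψ φu≈0 j = trans (◃-T φ u ψ j) (trans (+-congˡ (trans (*-congʳ φu≈0) (zeroˡ _))) (+-identityʳ _))

  T-▹-fixed : ∀ {n} (u φ v : Vect n) → φ ∙ v ≈ 0# → T u φ ▹ v ≈V v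
  T-▹-fixed u φ v φv≈0 i = trans (T-▹ u φ v i) (trans (+-congˡ (trans (*-congʳ φv≈0) (zeroˡ _))) (+-identityʳ _))

  module _ {n} {H : Mat n → Set} (N : NormalSubgroup H) where
    open NormalSubgroup N
    private
      module M = Monoid (*M-monoid n)
      ContainsTransvection : Set
      ContainsTransvection = ∃ λ w → ∃ λ ψ → Transvection w ψ × H (T w ψ)

    -- φ kills both e j and g (e j), so it is fixed by the commutator h of g with T (e j) (e i).
    off-diagonal₃ : ∀ {g i j b} → H g → i ≢ j → b ≢ i → b ≢ j → ¬ (g i j ≈ 0#) → ContainsTransvection
    off-diagonal₃ {g} {i} {j} {b} Hg i≢j b≢i b≢j gij≉0 = go (inv Hg)
      where
      x φ u : Vect n
      x = g ▹ e j
      φ = x b ⋆ e i +V - x i ⋆ e b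
      -- The projection of `x` to the coordinates `i` and `b`: `φ` only reads these two, so it kills
      -- `u` as it kills `x`, while `u i` stays nonzero so that `t′` moves `u`.
      u = x i ⋆ e i +V x b ⋆ e b
      xi≉0 : ¬ (x i ≈ 0#)
      xi≉0 eq = gij≉0 (trans (sym (▹-e g j i)) eq)
      φ∙ : ∀ v → φ ∙ v ≈ x b * v i + - x i * v b
      φ∙ v = trans (∙-+ˡ (x b ⋆ e i) (- x i ⋆ e b) v)
        (+-cong (trans (∙-⋆ˡ (x b) (e i) v) (*-congˡ (e-∙ i v))) (trans (∙-⋆ˡ (- x i) (e b) v) (*-congˡ (e-∙ b v))))
      φx≈0 : φ ∙ x ≈ 0#
      φx≈0 = trans (φ∙ x) (solve 2 (λ a b → b :* a :+ :- a :* b := con (+ 0)) refl (x i) (x b))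
      φej≈0 : ∀ c → φ ∙ (c ⋆ e j) ≈ 0#
      φej≈0 c = begin
        φ ∙ (c ⋆ e j)                              ≈⟨ ∙-⋆ʳ c φ (e j) ⟩
        c * (φ ∙ e j)                              ≈⟨ *-congˡ (φ∙ (e j)) ⟩
        c * (x b * e j i + - x i * e j b)          ≈⟨ *-congˡ (+-cong (*-congˡ (e-off (i≢j ∘ ≡.sym))) (*-congˡ (e-off (b≢j ∘ ≡.sym)))) ⟩
        c * (x b * 0# + - x i * 0#)                ≈⟨ solve 3 (λ c p r → c :* (p :* con (+ 0) :+ r :* con (+ 0)) := con (+ 0)) refl c (x b) (- x i) ⟩
        0#                                         ∎
      ui≈ : u i ≈ x i
      ui≈ = trans (+-cong (*-congˡ (e-diag i)) (*-congˡ (e-off b≢i))) (solve 2 (λ a b → a :* con (+ 1) :+ b :* con (+ 0) := a) refl (x i) (x b))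
      ub≈ : u b ≈ x b
      ub≈ = trans (+-cong (*-congˡ (e-off (b≢i ∘ ≡.sym))) (*-congˡ (e-diag b))) (solve 2 (λ a b → a :* con (+ 0) :+ b :* con (+ 1) := b) refl (x i) (x b))
      φu≈0 : φ ∙ u ≈ 0#
      φu≈0 = begin
        φ ∙ u                       ≈⟨ φ∙ u ⟩
        x b * u i + - x i * u b     ≈⟨ +-cong (*-congˡ ui≈) (*-congˡ ub≈) ⟩
        x b * x i + - x i * x b     ≈⟨ solve 2 (λ a b → b :* a :+ :- a :* b := con (+ 0)) refl (x i) (x b) ⟩
        0#                          ∎
      φ≉0 : NonZeroV φ
      φ≉0 = b , λ eq → xi≉0 (-‿≈0 (begin
        - x i                              ≈⟨ solve 2 (λ a b → :- a := b :* con (+ 0) :+ :- a :* con (+ 1)) refl (x i) (x b) ⟩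
        x b * 0# + - x i * 1#              ≈⟨ +-cong (*-congˡ (e-off (b≢i ∘ ≡.sym))) (*-congˡ (e-diag b)) ⟨
        φ b                                ≈⟨ eq ⟩
        0#                                 ∎))
      t t′ : Mat n
      t = T (e j) (e i)
      t′ = T (- 1# ⋆ e j) (e i)
      tt′ : ((t *M t′) ≈M I) × ((t′ *M t) ≈M I)
      tt′ = transvection-inverse (e j) (e i) (trans (e-∙ i (e j)) (e-off (i≢j ∘ ≡.sym)))
      go : (∃ λ g′ → ((g *M g′) ≈M I) × ((g′ *M g) ≈M I) × H g′) → ContainsTransvection
      go (g′ , gg′ , g′g , Hg′) =
        eigenvector⇒transvection N {h} {φ} {u} 1# Hh φh≈φ φ≉0 φu≈0 hu≉u
        where
        ψ : Vect n
        ψ = e i ◃ g′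
        h : Mat n
        h = T x ψ *M t′
        Hh : H h
        Hh = resp
          (≈M-trans (≈M-sym (M.assoc g (t *M g′) t′))
            (*M-cong {B = t′} (≈M-trans (≈M-sym (M.assoc g t g′)) (T-conj g g′ (e j) (e i) gg′)) ≈M-refl))
          (mul Hg (conj (proj₁ tt′) (proj₂ tt′) Hg′))
        φh≈φ : φ ◃ h ≈V 1# ⋆ φ
        φh≈φ s = begin
          (φ ◃ h) s                   ≈⟨ ◃-*M φ (T x ψ) t′ s ⟩
          ((φ ◃ T x ψ) ◃ t′) s        ≈⟨ ◃-cong {M = t′} (◃-T-fixed φ x ψ φx≈0) ≈M-refl s ⟩
          (φ ◃ t′) s                  ≈⟨ ◃-T-fixed φ (- 1# ⋆ e j) (e i) (φej≈0 (- 1#)) s ⟩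
          φ s                         ≈⟨ *-identityˡ _ ⟨
          1# * φ s                    ∎
        y : Vect n
        y = t′ ▹ u
        α : Carrier
        α = ψ ∙ y
        hu≈ : ∀ r → (h ▹ u) r ≈ u r + x i * (- 1# * e j r) + α * x r
        hu≈ r = begin
          (h ▹ u) r                                 ≈⟨ *M-▹ (T x ψ) t′ u r ⟩
          (T x ψ ▹ y) r                             ≈⟨ T-▹ x ψ y r ⟩
          y r + α * x r                             ≈⟨ +-congʳ (T-▹ (- 1# ⋆ e j) (e i) u r) ⟩
          u r + e i ∙ u * (- 1# * e j r) + α * x r  ≈⟨ +-congʳ (+-congˡ (*-congʳ (trans (e-∙ i u) ui≈))) ⟩
          u r + x i * (- 1# * e j r) + α * x r      ∎
        hu≉u : ¬ (h ▹ u ≈V 1# ⋆ u)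
        hu≉u eq = xi≉0 xi≈0
          where
          -- If `h` fixed `u`, then `x` scaled by `α` would be `e j` scaled by `x i`. Coordinate `i`
          -- forces `α` to vanish, and coordinate `j` then forces `x i` to vanish.
          αx≈ : ∀ r → α * x r ≈ x i * e j r
          αx≈ r = begin
            α * x r     ≈⟨ solve 4 (λ u a b c → c := (u :+ a :* (:- con (+ 1) :* b) :+ c) :- con (+ 1) :* u :+ a :* b) refl (u r) (x i) (e j r) (α * x r) ⟩
            (u r + x i * (- 1# * e j r) + α * x r) - 1# * u r + x i * e j r
              ≈⟨ +-congʳ (trans (+-congʳ (trans (sym (hu≈ r)) (eq r))) (-‿inverseʳ _)) ⟩
            0# + x i * e j r    ≈⟨ +-identityˡ _ ⟩
            x i * e j r         ∎
          α≈0 : α ≈ 0#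
          α≈0 = *-cancel-0 xi≉0 (trans (*-comm _ _) (trans (αx≈ i) (trans (*-congˡ (e-off (i≢j ∘ ≡.sym))) (zeroʳ _))))
          xi≈0 : x i ≈ 0#
          xi≈0 = begin
            x i           ≈⟨ *-identityʳ _ ⟨
            x i * 1#      ≈⟨ *-congˡ (e-diag j) ⟨
            x i * e j j   ≈⟨ αx≈ j ⟨
            α * x j       ≈⟨ *-congʳ α≈0 ⟩
            0# * x j      ≈⟨ zeroˡ _ ⟩
            0#            ∎

    -- D scales e j by a and fixes x = g (e j); then D g D⁻¹ g⁻¹ scales x by a⁻¹ and the functional θ by a.
    off-diagonal₂ : ∀ {g i j a} → H g → i ≢ j → ¬ (g i j ≈ 0#) →
      ¬ (a ≈ 0#) → ¬ (a * a ≈ 1#) → ContainsTransvection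
    off-diagonal₂ {g} {i} {j} {a} Hg i≢j gij≉0 a≉0 a²≉1 = go (inverse (x i) xi≉0)
      where
      x : Vect n
      x = g ▹ e j
      xi≉0 : ¬ (x i ≈ 0#)
      xi≉0 eq = gij≉0 (trans (sym (▹-e g j i)) eq)
      go : (∃ λ z → x i * z ≈ 1#) → ContainsTransvection
      go (z , xz≈1) = go₂ (inv Hg) (T-InGL ((a - 1#) ⋆ e j) θ (λ eq → a≉0 (trans (sym step) eq)))
        where
        -- Solves `x j + c * x i = 0`, so that `θ` kills `x` and still takes the value 1 on `e j`.
        c : Carrier
        c = - (x j * z)
        θ : Vect n
        θ = e j +V c ⋆ e i
        θ∙ : ∀ v → θ ∙ v ≈ v j + c * v i
        θ∙ v = trans (∙-+ˡ (e j) (c ⋆ e i) v) (+-cong (e-∙ j v) (trans (∙-⋆ˡ c (e i) v) (*-congˡ (e-∙ i v))))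
        θj≈1 : θ j ≈ 1#
        θj≈1 = trans (+-cong (e-diag j) (trans (*-congˡ (e-off i≢j)) (zeroʳ _))) (+-identityʳ _)
        θej≈1 : θ ∙ e j ≈ 1#
        θej≈1 = trans (∙-e j θ) θj≈1
        θx≈0 : θ ∙ x ≈ 0#
        θx≈0 = begin
          θ ∙ x                     ≈⟨ θ∙ x ⟩
          x j + - (x j * z) * x i   ≈⟨ solve 3 (λ p z r → p :+ :- (p :* z) :* r := p :- p :* (r :* z)) refl (x j) z (x i) ⟩
          x j - x j * (x i * z)     ≈⟨ +-congˡ (-‿cong (trans (*-congˡ xz≈1) (*-identityʳ _))) ⟩
          x j - x j                 ≈⟨ -‿inverseʳ _ ⟩
          0#                        ∎
        step : 1# + θ ∙ ((a - 1#) ⋆ e j) ≈ a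
        step = begin
          1# + θ ∙ ((a - 1#) ⋆ e j)   ≈⟨ +-congˡ (trans (∙-⋆ʳ (a - 1#) θ (e j)) (*-congˡ θej≈1)) ⟩
          1# + (a - 1#) * 1#          ≈⟨ solve 1 (λ a → con (+ 1) :+ (a :- con (+ 1)) :* con (+ 1) := a) refl a ⟩
          a                           ∎
        D : Mat n
        D = T ((a - 1#) ⋆ e j) θ
        go₂ : (∃ λ g′ → ((g *M g′) ≈M I) × ((g′ *M g) ≈M I) × H g′) → InGL D → ContainsTransvection
        go₂ (g′ , gg′ , g′g , Hg′) (D′ , DD′ , D′D) =
          eigenvector⇒transvection N {h} {θ} {x} a (mul (conj DD′ D′D Hg) Hg′) θh≈aθ
            (j , λ eq → 1≉0 (trans (sym θj≈1) eq)) θx≈0 hx≉ax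
          where
          h : Mat n
          h = ((D *M g) *M D′) *M g′
          θD≈aθ : θ ◃ D ≈V a ⋆ θ
          θD≈aθ s = begin
            (θ ◃ D) s                            ≈⟨ ◃-T θ ((a - 1#) ⋆ e j) θ s ⟩
            θ s + θ ∙ ((a - 1#) ⋆ e j) * θ s     ≈⟨ solve 2 (λ t d → t :+ d :* t := (con (+ 1) :+ d) :* t) refl (θ s) (θ ∙ ((a - 1#) ⋆ e j)) ⟩
            (1# + θ ∙ ((a - 1#) ⋆ e j)) * θ s    ≈⟨ *-congʳ step ⟩
            a * θ s                              ∎
          θgD≈θg : (θ ◃ g) ◃ D ≈V θ ◃ g
          θgD≈θg = ◃-T-fixed (θ ◃ g) ((a - 1#) ⋆ e j) θ (begin
            (θ ◃ g) ∙ ((a - 1#) ⋆ e j)     ≈⟨ ∙-⋆ʳ (a - 1#) (θ ◃ g) (e j) ⟩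
            (a - 1#) * ((θ ◃ g) ∙ e j)     ≈⟨ *-congˡ (trans (◃-∙-▹ θ g (e j)) θx≈0) ⟩
            (a - 1#) * 0#                  ≈⟨ zeroʳ _ ⟩
            0#                             ∎)
          θgD′≈θg : (θ ◃ g) ◃ D′ ≈V θ ◃ g
          θgD′≈θg s = trans (◃-cong {M = D′} (λ r → sym (θgD≈θg r)) ≈M-refl s) (◃-cancel (θ ◃ g) D D′ DD′ s)
          θh≈aθ : θ ◃ h ≈V a ⋆ θ
          θh≈aθ s = begin
            (θ ◃ h) s                           ≈⟨ ◃-*M θ ((D *M g) *M D′) g′ s ⟩
            ((θ ◃ ((D *M g) *M D′)) ◃ g′) s     ≈⟨ ◃-cong {M = g′} inner ≈M-refl s ⟩
            ((a ⋆ (θ ◃ g)) ◃ g′) s              ≈⟨ ◃-⋆ a (θ ◃ g) g′ s ⟩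
            a * ((θ ◃ g) ◃ g′) s                ≈⟨ *-congˡ (◃-cancel θ g g′ gg′ s) ⟩
            a * θ s                             ∎
            where
            inner : θ ◃ ((D *M g) *M D′) ≈V a ⋆ (θ ◃ g)
            inner r = begin
              (θ ◃ ((D *M g) *M D′)) r      ≈⟨ ◃-*M θ (D *M g) D′ r ⟩
              ((θ ◃ (D *M g)) ◃ D′) r       ≈⟨ ◃-cong {M = D′} (◃-*M θ D g) ≈M-refl r ⟩
              (((θ ◃ D) ◃ g) ◃ D′) r        ≈⟨ ◃-cong {M = D′} (◃-cong {M = g} θD≈aθ ≈M-refl) ≈M-refl r ⟩
              (((a ⋆ θ) ◃ g) ◃ D′) r        ≈⟨ ◃-cong {M = D′} (◃-⋆ a θ g) ≈M-refl r ⟩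
              ((a ⋆ (θ ◃ g)) ◃ D′) r        ≈⟨ ◃-⋆ a (θ ◃ g) D′ r ⟩
              a * ((θ ◃ g) ◃ D′) r          ≈⟨ *-congˡ (θgD′≈θg r) ⟩
              a * (θ ◃ g) r                 ∎
          Dej≈ : D ▹ e j ≈V a ⋆ e j
          Dej≈ r = begin
            (D ▹ e j) r                                ≈⟨ T-▹ ((a - 1#) ⋆ e j) θ (e j) r ⟩
            e j r + θ ∙ e j * ((a - 1#) * e j r)       ≈⟨ +-congˡ (*-congʳ θej≈1) ⟩
            e j r + 1# * ((a - 1#) * e j r)            ≈⟨ solve 2 (λ a t → t :+ con (+ 1) :* ((a :- con (+ 1)) :* t) := a :* t) refl a (e j r) ⟩
            a * e j r                                  ∎
          aD′ej≈ej : D′ ▹ (a ⋆ e j) ≈V e j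
          aD′ej≈ej r = trans (▹-cong {M = D′} ≈M-refl (λ s → sym (Dej≈ s)) r) (▹-cancel (e j) D′ D D′D r)
          ahx≈x : ∀ r → a * (h ▹ x) r ≈ x r
          ahx≈x r = begin
            a * (h ▹ x) r                             ≈⟨ ▹-⋆ h a x r ⟨
            (h ▹ (a ⋆ x)) r                           ≈⟨ *M-▹ ((D *M g) *M D′) g′ (a ⋆ x) r ⟩
            (((D *M g) *M D′) ▹ (g′ ▹ (a ⋆ x))) r     ≈⟨ ▹-cong {M = (D *M g) *M D′} ≈M-refl g′ax r ⟩
            (((D *M g) *M D′) ▹ (a ⋆ e j)) r          ≈⟨ *M-▹ (D *M g) D′ (a ⋆ e j) r ⟩
            ((D *M g) ▹ (D′ ▹ (a ⋆ e j))) r           ≈⟨ ▹-cong {M = D *M g} ≈M-refl aD′ej≈ej r ⟩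
            ((D *M g) ▹ e j) r                        ≈⟨ *M-▹ D g (e j) r ⟩
            (D ▹ x) r                                 ≈⟨ T-▹-fixed ((a - 1#) ⋆ e j) θ x θx≈0 r ⟩
            x r                                       ∎
            where
            g′ax : g′ ▹ (a ⋆ x) ≈V a ⋆ e j
            g′ax s = trans (▹-⋆ g′ a x s) (*-congˡ (▹-cancel (e j) g′ g g′g s))
          hx≉ax : ¬ (h ▹ x ≈V a ⋆ x)
          hx≉ax eq = a²≉1 (x-y≈0⇒x≈y (*-cancel-0 xi≉0 (begin
            x i * (a * a - 1#)            ≈⟨ solve 2 (λ a x → x :* (a :* a :- con (+ 1)) := a :* (a :* x) :- x) refl a (x i) ⟩
            a * (a * x i) - x i           ≈⟨ +-congʳ (trans (*-congˡ (sym (eq i))) (ahx≈x i)) ⟩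
            x i - x i                     ≈⟨ -‿inverseʳ _ ⟩
            0#                            ∎)))

    -- Here `g` needs no commutator to acquire an eigenvector: `e i` is one with eigenvalue `g i i`,
    -- and `e j` in its kernel is scaled by the different factor `g j j`.
    diagonal : ∀ {g i j} → H g → (∀ r s → r ≢ s → g r s ≈ 0#) → ¬ (g i i ≈ g j j) → ContainsTransvection
    diagonal {g} {i} {j} Hg off gii≉gjj = eigenvector⇒transvection N {g} {e i} {e j} (g i i) Hg eigen
      (i , λ eq → 1≉0 (trans (sym (e-diag i)) eq))
      (trans (e-∙ i (e j)) (e-off (λ j≡i → gii≉gjj (reflexive (≡.cong (λ r → g r r) (≡.sym j≡i))))))
      (λ eq → gii≉gjj (begin
        g i i               ≈⟨ *-identityʳ _ ⟨
        g i i * 1#          ≈⟨ *-congˡ (e-diag j) ⟨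
        g i i * e j j       ≈⟨ eq j ⟨
        (g ▹ e j) j         ≈⟨ ▹-e g j j ⟩
        g j j               ∎))
      where
      eigen : e i ◃ g ≈V g i i ⋆ e i
      eigen s with i Fin.≟ s
      ... | yes ≡.refl = trans (e-∙ i (λ r → g r i)) (sym (trans (*-congˡ (e-diag i)) (*-identityʳ _)))
      ... | no i≢s = trans (e-∙ i (λ r → g r s)) (trans (off i s i≢s) (sym (trans (*-congˡ (e-off i≢s)) (zeroʳ _))))

  -- In a field `a * a = 1` only for `a = 1` and `a = -1`, so three values are to be avoided. In
  -- characteristic 2 the list `excluded` merely repeats one.
  exists-square≉1 : 4 ℕ.≤ q → ∃ λ a → ¬ (a ≈ 0#) × ¬ (a * a ≈ 1#)
  exists-square≉1 4≤q = go (missed-value 4≤q excluded)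
    where
    excluded : Fin 3 → Fin q
    excluded zero             = index 0#
    excluded (suc zero)       = index 1#
    excluded (suc (suc zero)) = index (- 1#)
    go : (∃ λ j → ∀ i → excluded i ≢ j) → ∃ λ a → ¬ (a ≈ 0#) × ¬ (a * a ≈ 1#)
    go (j , miss) = a , (λ eq → apart zero (trans eq (sym (enum-index 0#)))) , λ a²≈1 → a+1≉0 (*-cancel-0 a-1≉0 (begin
        (a - 1#) * (a + 1#)  ≈⟨ solve 1 (λ a → (a :- con (+ 1)) :* (a :+ con (+ 1)) := a :* a :- con (+ 1)) refl a ⟩
        a * a - 1#           ≈⟨ +-congʳ a²≈1 ⟩
        1# - 1#              ≈⟨ -‿inverseʳ 1# ⟩
        0#                   ∎))
      where
      a : Carrier
      a = enum j
      apart : ∀ i → ¬ (a ≈ enum (excluded i))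
      apart i eq = miss i (enum-injective _ _ (sym eq))
      a-1≉0 : ¬ (a - 1# ≈ 0#)
      a-1≉0 eq = apart (suc zero) (trans (x-y≈0⇒x≈y eq) (sym (enum-index 1#)))
      a+1≉0 : ¬ (a + 1# ≈ 0#)
      a+1≉0 eq = apart (suc (suc zero)) (trans (x-y≈0⇒x≈y (trans (solve 1 (λ a → a :- :- con (+ 1) := a :+ con (+ 1)) refl a) eq)) (sym (enum-index (- 1#))))

  -- A nonzero functional that kills both `e j` and `g (e j)` needs a third dimension, as
  -- `g i j ≠ 0` makes these vectors independent. For `n = 2` the commutator with a dilation takes
  -- over; its eigenvalues `a` and `a⁻¹` must differ, which is possible exactly from `q = 4` on.
  off-diagonal : ∀ {n} {H : Mat n → Set} → NormalSubgroup H → n ℕ.≥ 2 → (n ≡ 2 → 4 ℕ.≤ q) →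
    ∀ {g i j} → H g → i ≢ j → ¬ (g i j ≈ 0#) → ∃ λ w → ∃ λ ψ → Transvection w ψ × H (T w ψ)
  off-diagonal {suc (suc zero)} N _ big Hg i≢j gij≉0 =
    let (a , a≉0 , a²≉1) = exists-square≉1 (big ≡.refl) in off-diagonal₂ N Hg i≢j gij≉0 a≉0 a²≉1
  off-diagonal {suc (suc (suc m))} N _ _ {i = i} {j} Hg i≢j gij≉0 =
    let (b , miss) = missed-value {2} (s≤s (s≤s (s≤s z≤n))) (λ { zero → i ; (suc zero) → j })
    in off-diagonal₃ N Hg i≢j (miss zero ∘ ≡.sym) (miss (suc zero) ∘ ≡.sym) gij≉0
  off-diagonal {suc zero} N (s≤s ()) big Hg i≢j gij≉0

  non-scalar⇒all-transvections : ∀ {n} {H : Mat n → Set} → NormalSubgroup H → n ℕ.≥ 2 → (n ≡ 2 → 4 ℕ.≤ q) →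
    ∀ {g} → H g → ¬ (∃ λ a → g ≈M scalar a) → ∀ {u φ} → Transvection u φ → H (T u φ)
  non-scalar⇒all-transvections {suc n} {H} N n≥2 big {g} Hg g≉scalar tv =
    let (_ , _ , tv₀ , HT₀) = found in all-transvections N tv₀ HT₀ tv
    where
    scalar-diag : ∀ {m} a (i : Fin m) → scalar a i i ≈ a
    scalar-diag a zero    = refl
    scalar-diag a (suc i) = scalar-diag a i
    scalar-off : ∀ {m} a {i j : Fin m} → i ≢ j → scalar a i j ≈ 0#
    scalar-off a {zero}  {zero}  i≢j = ⊥-elim (i≢j ≡.refl)
    scalar-off a {zero}  {suc j} i≢j = refl
    scalar-off a {suc i} {zero}  i≢j = refl
    scalar-off a {suc i} {suc j} i≢j = scalar-off a (i≢j ∘ ≡.cong suc)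
    is-scalar : (∀ r s → r ≢ s → g r s ≈ 0#) → (∀ i → g i i ≈ g zero zero) → g ≈M scalar (g zero zero)
    is-scalar off diag r s with r Fin.≟ s
    ... | yes ≡.refl = trans (diag r) (sym (scalar-diag _ r))
    ... | no r≢s = trans (off r s r≢s) (sym (scalar-off _ r≢s))
    found : ∃ λ w → ∃ λ ψ → Transvection w ψ × H (T w ψ)
    found with Fin.any? (λ r → Fin.any? (λ s → ¬? (r Fin.≟ s) ×-dec ¬? (g r s ≈? 0#)))
    ... | yes (r , s , r≢s , grs≉0) = off-diagonal N n≥2 big Hg r≢s grs≉0
    ... | no none with Fin.any? (λ i → ¬? (g i i ≈? g zero zero))
    ...   | yes (i , ne) = diagonal N Hg (λ r s r≢s → decidable-stable (_ ≈? _) (λ ne′ → none (r , s , r≢s , ne′))) ne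
    ...   | no none′ = ⊥-elim (g≉scalar (g zero zero ,
              is-scalar (λ r s r≢s → decidable-stable (_ ≈? _) (λ ne′ → none (r , s , r≢s , ne′)))
                        (λ i → decidable-stable (_ ≈? _) (λ ne → none′ (i , ne)))))

  record ConjugationInvariant {n} (S : Mat n → Set) : Set where
    field
      S-resp : ∀ {A B} → A ≈M B → S A → S B
      S-conj : ∀ {A c c′} → (c *M c′) ≈M I → (c′ *M c) ≈M I → S A → S ((c *M A) *M c′)

  conj-InGL : ∀ {n} {c c′ A : Mat n} → (c *M c′) ≈M I → (c′ *M c) ≈M I → InGL A → InGL ((c *M A) *M c′)
  conj-InGL {n} {c} {c′} {A} cc′ c′c (B , AB , BA) = (c *M B) *M c′
    , M.trans (conj-∙ c′c A B) (M.trans (M.∙-congʳ {x = c′} (M.∙-congˡ {x = c} AB)) (conj-ε cc′))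
    , M.trans (conj-∙ c′c B A) (M.trans (M.∙-congʳ {x = c′} (M.∙-congˡ {x = c} BA)) (conj-ε cc′))
    where
    module M = Monoid (*M-monoid n)
    open Conjugation (*M-monoid n)

  module _ {n} {S : Mat n → Set} (C : ConjugationInvariant S) where
    open ConjugationInvariant C
    private module M = Monoid (*M-monoid n)
    open import Algebra.Properties.Monoid (*M-monoid n) using (cancelˡ)
    open Conjugation (*M-monoid n)

    -- Normality comes from `(c a c⁻¹) s = c (a (c⁻¹ s c)) c⁻¹`: conjugate `s` inside `S`, apply
    -- `a`, and conjugate back.
    InL-normal : NormalSubgroup (InL S)
    InL-normal = record { resp = resp ; mul = mul ; inv = inv ; conj = conj }
      where
      resp : ∀ {a b} → a ≈M b → InL S a → InL S b
      resp a≈b ((a′ , aa′ , a′a) , into , onto) =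
          (a′ , M.trans (M.∙-congʳ (M.sym a≈b)) aa′ , M.trans (M.∙-congˡ {x = a′} (M.sym a≈b)) a′a)
        , (λ s Ss → S-resp (M.∙-congʳ a≈b) (into s Ss))
        , (λ t St → let (s , Ss , eq) = onto t St in s , Ss , M.trans (M.∙-congʳ (M.sym a≈b)) eq)
      mul : ∀ {a b} → InL S a → InL S b → InL S (a *M b)
      mul {a} {b} ((a′ , aa′ , a′a) , into , onto) ((b′ , bb′ , b′b) , into′ , onto′) =
          (b′ *M a′
            , M.trans (M.assoc a b (b′ *M a′)) (M.trans (M.∙-congˡ {x = a} (cancelˡ bb′ a′)) aa′)
            , M.trans (M.assoc b′ a′ (a *M b)) (M.trans (M.∙-congˡ {x = b′} (cancelˡ a′a b)) b′b))
        , (λ s Ss → S-resp (M.sym (M.assoc a b s)) (into (b *M s) (into′ s Ss)))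
        , (λ t St → let (s , Ss , eq) = onto t St ; (r , Sr , eq′) = onto′ s Ss in
            r , Sr , M.trans (M.assoc a b r) (M.trans (M.∙-congˡ {x = a} eq′) eq))
      inv : ∀ {a} → InL S a → ∃ λ a′ → ((a *M a′) ≈M I) × ((a′ *M a) ≈M I) × InL S a′
      inv {a} ((a′ , aa′ , a′a) , into , onto) = a′ , aa′ , a′a
        , (a , a′a , aa′)
        -- That `a` maps `S` onto `S` is precisely that `a′` maps `S` into `S`.
        , (λ s Ss → let (r , Sr , eq) = onto s Ss in
            S-resp (M.trans (M.sym (cancelˡ a′a r)) (M.∙-congˡ {x = a′} eq)) Sr)
        , (λ t St → a *M t , into t St , cancelˡ a′a t)
      conj : ∀ {a c c′} → (c *M c′) ≈M I → (c′ *M c) ≈M I → InL S a → InL S ((c *M a) *M c′)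
      conj {a} {c} {c′} cc′ c′c (a-GL , into , onto) =
          conj-InGL cc′ c′c a-GL
        , (λ s Ss → S-resp (M.trans (M.sym (conj-∙ c′c a ((c′ *M s) *M c))) (M.∙-congˡ {x = (c *M a) *M c′} (conj-conj cc′ s)))
            (S-conj cc′ c′c (into _ (S-conj c′c cc′ Ss))))
        , (λ t St → let (s , Ss , eq) = onto _ (S-conj c′c cc′ St) in
            (c *M s) *M c′ , S-conj cc′ c′c Ss
            , M.trans (conj-∙ c′c a s) (M.trans (M.∙-congʳ {x = c′} (M.∙-congˡ {x = c} eq)) (conj-conj cc′ t)))

-- Reduction by elementary row and column operations

module Reduction {q : ℕ} (F : FiniteField q) where
  open FiniteField F hiding (zero)
  open Matrices F
  open LinearAlgebra F
  open Transvections F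
  open NormalSubgroups F
  open import Relation.Binary.Reasoning.Setoid setoid

  NonZeroM : ∀ {n} → Mat n → Set
  NonZeroM M = ∃ λ i → ∃ λ j → ¬ (M i j ≈ 0#)

  zeroOrNonZeroM : ∀ {n} (M : Mat n) → (M ≈M 0M) ⊎ NonZeroM M
  zeroOrNonZeroM M with Fin.any? (λ i → Fin.any? (λ j → ¬? (M i j ≈? 0#)))
  ... | yes p = inj₂ p
  ... | no ¬p = inj₁ (λ i j → decidable-stable (M i j ≈? 0#) (λ ne → ¬p (i , j , ne)))

  -- The operations are phrased backwards, as reductions of the goal `S M` to a simpler matrix. A
  -- whole vector of multiples of row `r` is added at once, which is left multiplication by
  -- `T u (e r)`; `u r ≈ 0#` makes that factor a transvection or `I`. Phrased by entries, the notion
  -- passes to a lower right block.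
  record Closed {n} (S : Mat n → Set) : Set where
    field
      resp : ∀ {A B} → A ≈M B → S A → S B
      row  : ∀ M (u : Vect n) r → u r ≈ 0# → S (λ i j → M i j + u i * M r j) → S M
      col  : ∀ M (v : Vect n) r → v r ≈ 0# → S (λ i j → M i j + M i r * v j) → S M

  module _ {n} {S : Mat n → Set} (C : ConjugationInvariant S)
           (all : ∀ {u φ} → Transvection u φ → InL S (T u φ)) where
    open ConjugationInvariant C
    private module M = Monoid (*M-monoid n)
    open import Algebra.Properties.Monoid (*M-monoid n) using (cancelˡ; cancelʳ)

    cancel-transvection : ∀ {u φ} → Transvection u φ → ∀ M → S (T u φ *M M) → S M
    cancel-transvection {u} {φ} tv M ST =
      let (s , Ss , eq) = proj₂ (proj₂ (all tv)) _ ST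
          t′t = proj₂ (transvection-inverse u φ (Transvection.φu≈0 tv))
      in S-resp (M.trans (M.sym (cancelˡ t′t s)) (M.trans (M.∙-congˡ {x = T (- 1# ⋆ u) φ} eq) (cancelˡ t′t M))) Ss

    -- Membership in `L_S` speaks of left multiplication only. For columns, `t (M t) t⁻¹ = t M`, so
    -- conjugation invariance trades a right factor for a left one.
    transvections⇒Closed : Closed S
    transvections⇒Closed = record { resp = S-resp ; row = row ; col = col }
      where
      nz-e : ∀ r → NonZeroV (e r)
      nz-e r = r , λ eq → 1≉0 (trans (sym (e-diag r)) eq)
      row : ∀ M u r → u r ≈ 0# → S (λ i j → M i j + u i * M r j) → S M
      row M u r ur≈0 SM with Fin.any? (λ i → ¬? (u i ≈? 0#))
      ... | no u≈0 = S-resp (λ i j → trans (+-congˡ (trans (*-congʳ (decidable-stable (u i ≈? 0#) (λ ne → u≈0 (i , ne)))) (zeroˡ _))) (+-identityʳ _)) SM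
      ... | yes u≉0 = cancel-transvection (transvection (trans (e-∙ r u) ur≈0) u≉0 (nz-e r)) M
        (S-resp (λ i j → sym (trans (T-▹ u (e r) (λ s → M s j) i) (+-congˡ (trans (*-congʳ (e-∙ r _)) (*-comm _ _))))) SM)
      col : ∀ M v r → v r ≈ 0# → S (λ i j → M i j + M i r * v j) → S M
      col M v r vr≈0 SM with Fin.any? (λ i → ¬? (v i ≈? 0#))
      ... | no v≈0 = S-resp (λ i j → trans (+-congˡ (trans (*-congˡ (decidable-stable (v j ≈? 0#) (λ ne → v≈0 (j , ne)))) (zeroʳ _))) (+-identityʳ _)) SM
      ... | yes v≉0 = cancel-transvection (transvection vt (nz-e r) v≉0) M
        (S-resp (M.trans (M.∙-congʳ {x = t′} (M.sym (M.assoc t M t))) (cancelʳ (proj₁ tt′) (t *M M)))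
          (S-conj (proj₁ tt′) (proj₂ tt′) 
            (S-resp (λ i j → sym (trans (◃-T (M i) (e r) v j) (+-congˡ (*-congʳ (∙-e r (M i)))))) SM)))
        where
        vt : v ∙ e r ≈ 0#
        vt = trans (∙-e r v) vr≈0
        t t′ : Mat n
        t = T (e r) v
        t′ = T (- 1# ⋆ e r) v
        tt′ = transvection-inverse (e r) v vt

  infixr 5 _⊕_
  _⊕_ : ∀ {n} → Carrier → Mat n → Mat (suc n)
  (a ⊕ M) zero    zero    = a
  (a ⊕ M) zero    (suc j) = 0#
  (a ⊕ M) (suc i) zero    = 0#
  (a ⊕ M) (suc i) (suc j) = M i j

  ⊕-cong : ∀ {n} a {M N : Mat n} → M ≈M N → (a ⊕ M) ≈M (a ⊕ N)
  ⊕-cong a eq zero    zero    = refl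
  ⊕-cong a eq zero    (suc j) = refl
  ⊕-cong a eq (suc i) zero    = refl
  ⊕-cong a eq (suc i) (suc j) = eq i j

  ⊕-*M : ∀ {n} a b (M N : Mat n) → ((a ⊕ M) *M (b ⊕ N)) ≈M ((a * b) ⊕ (M *M N))
  ⊕-*M {n} a b M N zero zero = trans (+-congˡ (trans (∑-cong n (λ r → zeroˡ 0#)) (∑-0 n))) (+-identityʳ _)
  ⊕-*M {n} a b M N zero (suc j) = trans (+-cong (zeroʳ a) (trans (∑-cong n (λ r → zeroˡ _)) (∑-0 n))) (+-identityʳ _)
  ⊕-*M {n} a b M N (suc i) zero = trans (+-cong (zeroˡ b) (trans (∑-cong n (λ r → zeroʳ _)) (∑-0 n))) (+-identityʳ _)
  ⊕-*M {n} a b M N (suc i) (suc j) = trans (+-congʳ (zeroˡ _)) (+-identityˡ _)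

  cons : ∀ {n} → Carrier → Vect n → Vect (suc n)
  cons a u zero    = a
  cons a u (suc i) = u i

  module _ {n} {S : Mat (suc n) → Set} (C : Closed S) where
    open Closed C

    ⊕-Closed : Closed (λ M → S (1# ⊕ M))
    ⊕-Closed = record
      { resp = λ eq → resp (⊕-cong 1# eq)
      ; row  = λ M u r ur≈0 SM → row (1# ⊕ M) (cons 0# u) (suc r) ur≈0 (resp (λ
          { zero zero → sym (trans (+-congˡ (zeroˡ _)) (+-identityʳ _))
          ; zero (suc j) → sym (trans (+-congˡ (zeroˡ _)) (+-identityʳ _))
          ; (suc i) zero → sym (trans (+-congˡ (zeroʳ _)) (+-identityʳ _))
          ; (suc i) (suc j) → refl }) SM)
      ; col  = λ M v r vr≈0 SM → col (1# ⊕ M) (cons 0# v) (suc r) vr≈0 (resp (λ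
          { zero zero → sym (trans (+-congˡ (zeroˡ _)) (+-identityʳ _))
          ; zero (suc j) → sym (trans (+-congˡ (zeroˡ _)) (+-identityʳ _))
          ; (suc i) zero → sym (trans (+-congˡ (zeroʳ _)) (+-identityʳ _))
          ; (suc i) (suc j) → refl }) SM) }

    -- Gaussian elimination with pivot 1: first row 0 is cleared, then column 0, and the block that
    -- remains is the Schur complement.
    split-pivot : (∀ M → S (1# ⊕ M)) → ∀ M → M zero zero ≈ 1# → S M
    split-pivot S⊕ M M₀₀≈1 = col M v zero refl (row N u zero refl (resp cleared (S⊕ (λ i j → N (suc i) (suc j)))))
      where
      v u : Vect (suc n)
      v = cons 0# (λ j → - M zero (suc j))
      N : Mat (suc n)
      N i j = M i j + M i zero * v j
      u = cons 0# (λ i → - N (suc i) zero)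
      N₀₀ : N zero zero ≈ 1#
      N₀₀ = trans (+-congˡ (zeroʳ _)) (trans (+-identityʳ _) M₀₀≈1)
      N₀ : ∀ j → N zero (suc j) ≈ 0#
      N₀ j = trans (+-congˡ (trans (*-congʳ M₀₀≈1) (*-identityˡ _))) (-‿inverseʳ _)
      cleared : (1# ⊕ (λ i j → N (suc i) (suc j))) ≈M (λ i j → N i j + u i * N zero j)
      cleared zero    zero    = sym (trans (+-congˡ (zeroˡ _)) (trans (+-identityʳ _) N₀₀))
      cleared zero    (suc j) = sym (trans (+-congˡ (zeroˡ _)) (trans (+-identityʳ _) (N₀ j)))
      cleared (suc i) zero    = sym (trans (+-congˡ (trans (*-congˡ N₀₀) (*-identityʳ _))) (-‿inverseʳ _))
      cleared (suc i) (suc j) = sym (trans (+-congˡ (trans (*-congˡ (N₀ j)) (zeroʳ _))) (+-identityʳ _))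

  module _ {n} {S : Mat (suc (suc n)) → Set} (C : Closed S) where
    open Closed C
    private
      0F 1F : Fin (suc (suc n))
      0F = zero
      1F = suc zero

    -- A nonzero entry is brought to row 0 and then to column 1. From there a suitable multiple of
    -- column 1 turns the corner into 1, whatever the corner was before.
    pivot : (∀ M → M 0F 0F ≈ 1# → S M) → ∀ M → NonZeroM M → S M
    pivot S₁ M (i , j , Mij≉0) = row-i M i j Mij≉0
      where
      row0-col1 : ∀ M → ¬ (M 0F 1F ≈ 0#) → S M
      row0-col1 M ne =
        let (z , Mz≈1) = inverse (M 0F 1F) ne
            c = (1# - M 0F 0F) * z
        in col M (c ⋆ e 0F) 1F (zeroʳ c) (S₁ _ (begin
          M 0F 0F + M 0F 1F * (c * 1#)
            ≈⟨ solve 3 (λ a b z → a :+ b :* ((con (+ 1) :- a) :* z :* con (+ 1)) := a :+ (con (+ 1) :- a) :* (b :* z)) refl (M 0F 0F) (M 0F 1F) z ⟩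
          M 0F 0F + (1# - M 0F 0F) * (M 0F 1F * z)    ≈⟨ +-congˡ (*-congˡ Mz≈1) ⟩
          M 0F 0F + (1# - M 0F 0F) * 1#               ≈⟨ solve 1 (λ a → a :+ (con (+ 1) :- a) :* con (+ 1) := con (+ 1)) refl (M 0F 0F) ⟩
          1#                                          ∎))
      row0 : ∀ M j → ¬ (M 0F j ≈ 0#) → S M
      row0 M j ne with M 0F 1F ≈? 0#
      ... | no ne′ = row0-col1 M ne′
      ... | yes eq = col M (e 1F) j (e-off {i = 1F} {j} (λ { ≡.refl → ne eq }))
        (row0-col1 _ (λ eq′ → ne (trans (sym (trans (+-cong eq (*-identityʳ _)) (+-identityˡ _))) eq′)))
      row-i : ∀ M i j → ¬ (M i j ≈ 0#) → S M
      row-i M i j ne with M 0F j ≈? 0#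
      ... | no ne′ = row0 M j ne′
      ... | yes eq = row M (e 0F) i (e-off {i = 0F} {i} (λ { ≡.refl → ne eq }))
        (row0 _ j (λ eq′ → ne (trans (sym (trans (+-cong eq (*-identityˡ _)) (+-identityˡ _))) eq′)))

    -- From a corner 1, column operations make row 0 constant 1. Multiples of row 0 then set each
    -- later diagonal entry to `t`, and a multiple of column 1 sets the corner without touching the
    -- rest of the diagonal.
    constant-diagonal : ∀ t → (∀ M → (∀ i → M i i ≈ t) → S M) → ∀ M → NonZeroM M → S M
    constant-diagonal t St = pivot unit-corner
      where
      almost-constant : ∀ M → (∀ j → M 0F j ≈ 1#) → (∀ s → M (suc s) (suc s) ≈ t) → S M
      almost-constant M row0 diag = col M ((t - 1#) ⋆ e 0F) 1F (zeroʳ _) (St _ (λ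
        { zero → begin
            M 0F 0F + M 0F 1F * ((t - 1#) * 1#)   ≈⟨ +-cong (row0 0F) (*-congʳ (row0 1F)) ⟩
            1# + 1# * ((t - 1#) * 1#)             ≈⟨ solve 1 (λ t → con (+ 1) :+ con (+ 1) :* ((t :- con (+ 1)) :* con (+ 1)) := t) refl t ⟩
            t                                     ∎
        ; (suc s) → begin
            M (suc s) (suc s) + M (suc s) 1F * ((t - 1#) * 0#)   ≈⟨ +-congˡ (trans (*-congˡ (zeroʳ _)) (zeroʳ _)) ⟩
            M (suc s) (suc s) + 0#                ≈⟨ +-identityʳ _ ⟩
            M (suc s) (suc s)                     ≈⟨ diag s ⟩
            t                                     ∎ }))
      unit-row : ∀ M → (∀ j → M 0F j ≈ 1#) → S M
      unit-row M row0 = row M (cons 0# (λ s → t - M (suc s) (suc s))) 0F refl (almost-constant _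
        (λ j → trans (+-congˡ (zeroˡ _)) (trans (+-identityʳ _) (row0 j)))
        (λ s → begin
          M (suc s) (suc s) + (t - M (suc s) (suc s)) * M 0F (suc s)  ≈⟨ +-congˡ (*-congˡ (row0 (suc s))) ⟩
          M (suc s) (suc s) + (t - M (suc s) (suc s)) * 1#            ≈⟨ solve 2 (λ a t → a :+ (t :- a) :* con (+ 1) := t) refl (M (suc s) (suc s)) t ⟩
          t                                                           ∎))
      unit-corner : ∀ M → M 0F 0F ≈ 1# → S M
      unit-corner M M₀₀≈1 = col M (cons 0# (λ s → 1# - M 0F (suc s))) 0F refl (unit-row _ (λ
        { zero → trans (+-congˡ (zeroʳ _)) (trans (+-identityʳ _) M₀₀≈1)
        ; (suc s) → begin
            M 0F (suc s) + M 0F 0F * (1# - M 0F (suc s))   ≈⟨ +-congˡ (*-congʳ M₀₀≈1) ⟩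
            M 0F (suc s) + 1# * (1# - M 0F (suc s))        ≈⟨ solve 1 (λ a → a :+ con (+ 1) :* (con (+ 1) :- a) := con (+ 1)) refl (M 0F (suc s)) ⟩
            1#                                             ∎ }))

  Idempotent : ∀ {n} → Mat n → Set
  Idempotent E = (E *M E) ≈M E

  0M-idempotent : ∀ {n} → Idempotent (0M {n})
  0M-idempotent {n} i j = trans (∑-cong n (λ r → zeroˡ 0#)) (∑-0 n)

  ⊕-idempotent : ∀ {n} a {E : Mat n} → a * a ≈ a → Idempotent E → Idempotent (a ⊕ E)
  ⊕-idempotent a {E} aa EE i j = trans (⊕-*M a a E E i j) (scale i j)
    where
    scale : ((a * a) ⊕ (E *M E)) ≈M (a ⊕ E)
    scale zero    zero    = aa
    scale zero    (suc j) = refl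
    scale (suc i) zero    = refl
    scale (suc i) (suc j) = EE i j

  -- Induction on the size for all closed `S` at once, because the step passes to `M ↦ S (1# ⊕ M)`.
  -- The corner 1 is shared out as 1 + 0, both idempotent. The base is size 2, since `pivot` uses a
  -- second column.
  idempotent-sums : ∀ n {S : Mat (suc (suc n)) → Set} → Closed S →
    (∀ E E′ → Idempotent E → Idempotent E′ → S (E +M E′)) → ∀ M → S M
  idempotent-sums n {S} C SE M = go n C SE M (zeroOrNonZeroM M)
    where
    go : ∀ n {S : Mat (suc (suc n)) → Set} → Closed S →
      (∀ E E′ → Idempotent E → Idempotent E′ → S (E +M E′)) → ∀ M → (M ≈M 0M) ⊎ NonZeroM M → S M
    go n C SE M (inj₁ M≈0) = Closed.resp C (λ i j → trans (+-identityˡ _) (sym (M≈0 i j)))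
      (SE 0M 0M 0M-idempotent 0M-idempotent)
    go zero {S} C SE M (inj₂ M≉0) = constant-diagonal C 1# two-by-two M M≉0
      where
      two-by-two : ∀ M → (∀ i → M i i ≈ 1#) → S M
      two-by-two M diag = Closed.resp C sums (SE E E′ EE E′E′)
        where
        x y : Carrier
        x = M zero (suc zero)
        y = M (suc zero) zero
        -- Each summand keeps one row of `M`; a matrix with a single nonzero row and diagonal entry
        -- 1 in it is idempotent.
        E E′ : Mat 2
        E zero zero = 1#
        E zero (suc zero) = x
        E (suc i) j = 0#
        E′ zero j = 0#
        E′ (suc i) zero = y
        E′ (suc i) (suc j) = 1#
        EE : Idempotent E
        EE zero zero = solve 1 (λ x → con (+ 1) :* con (+ 1) :+ (x :* con (+ 0) :+ con (+ 0)) := con (+ 1)) refl x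
        EE zero (suc zero) = solve 1 (λ x → con (+ 1) :* x :+ (x :* con (+ 0) :+ con (+ 0)) := x) refl x
        EE (suc zero) j = trans (+-cong (zeroˡ _) (trans (+-identityʳ _) (zeroˡ _))) (+-identityʳ _)
        E′E′ : Idempotent E′
        E′E′ zero j = trans (+-cong (zeroˡ _) (trans (+-identityʳ _) (zeroˡ _))) (+-identityʳ _)
        E′E′ (suc zero) zero = solve 1 (λ y → y :* con (+ 0) :+ (con (+ 1) :* y :+ con (+ 0)) := y) refl y
        E′E′ (suc zero) (suc zero) = solve 1 (λ y → y :* con (+ 0) :+ (con (+ 1) :* con (+ 1) :+ con (+ 0)) := con (+ 1)) refl y
        sums : (E +M E′) ≈M M
        sums zero zero = trans (+-identityʳ _) (sym (diag zero))
        sums zero (suc zero) = +-identityʳ _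
        sums (suc zero) zero = +-identityˡ _
        sums (suc zero) (suc zero) = trans (+-identityˡ _) (sym (diag (suc zero)))
    go (suc n) {S} C SE M (inj₂ M≉0) = pivot C (split-pivot C S⊕) M M≉0
      where
      SE⊕ : ∀ E E′ → Idempotent E → Idempotent E′ → S (1# ⊕ (E +M E′))
      SE⊕ E E′ EE E′E′ = Closed.resp C (λ
        { zero zero → +-identityʳ _
        ; zero (suc j) → +-identityʳ _
        ; (suc i) zero → +-identityʳ _
        ; (suc i) (suc j) → refl })
        (SE (1# ⊕ E) (0# ⊕ E′) (⊕-idempotent 1# (*-identityʳ _) EE) (⊕-idempotent 0# (zeroʳ _) E′E′))
      S⊕ : ∀ M → S (1# ⊕ M)
      S⊕ M = go n (⊕-Closed C) SE⊕ M (zeroOrNonZeroM M)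

-- Determinants and invertibility

data Adjacent : ∀ {n} → Fin n → Fin n → Set where
  here  : ∀ {n} → Adjacent {suc (suc n)} zero (suc zero)
  there : ∀ {n} {a b : Fin n} → Adjacent a b → Adjacent (suc a) (suc b)

adjacent-inject₁ : ∀ {n} (c : Fin n) → Adjacent (inject₁ c) (suc c)
adjacent-inject₁ zero    = here
adjacent-inject₁ (suc c) = there (adjacent-inject₁ c)

adjacent-≢ : ∀ {n} {a b : Fin n} → Adjacent a b → a ≢ b
adjacent-≢ (there adj) eq = adjacent-≢ adj (Fin.suc-injective eq)

toℕ-adjacent : ∀ {n} {a b : Fin n} → Adjacent a b → toℕ b ≡ suc (toℕ a)
toℕ-adjacent here        = ≡.refl
toℕ-adjacent (there adj) = ≡.cong suc (toℕ-adjacent adj)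

punchIn-adjacent : ∀ {n} {a b : Fin (suc n)} → Adjacent a b → ∀ j → (j ≡ a) ⊎ (j ≡ b) ⊎
  ∃₂ λ a′ b′ → Adjacent a′ b′ × punchIn j a′ ≡ a × punchIn j b′ ≡ b
punchIn-adjacent here zero = inj₁ ≡.refl
punchIn-adjacent here (suc zero) = inj₂ (inj₁ ≡.refl)
punchIn-adjacent here (suc (suc zero)) = inj₂ (inj₂ (zero , suc zero , here , ≡.refl , ≡.refl))
punchIn-adjacent here (suc (suc (suc j))) = inj₂ (inj₂ (zero , suc zero , here , ≡.refl , ≡.refl))
punchIn-adjacent (there adj) zero = inj₂ (inj₂ (_ , _ , adj , ≡.refl , ≡.refl))
punchIn-adjacent {suc n} (there adj) (suc j) with punchIn-adjacent adj j
... | inj₁ eq = inj₁ (≡.cong suc eq)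
... | inj₂ (inj₁ eq) = inj₂ (inj₁ (≡.cong suc eq))
... | inj₂ (inj₂ (a′ , b′ , adj′ , eq , eq′)) = inj₂ (inj₂ (suc a′ , suc b′ , there adj′ , ≡.cong suc eq , ≡.cong suc eq′))

module Determinants {q : ℕ} (F : FiniteField q) where
  open FiniteField F hiding (zero)
  open Matrices F
  open LinearAlgebra F
  open Transvections F
  open import Relation.Binary.Reasoning.Setoid setoid

  sign-* : ∀ m x → sign m x ≈ sign m 1# * x
  sign-* zero    x = sym (*-identityˡ x)
  sign-* (suc m) x = trans (-‿cong (sign-* m x)) (solve 2 (λ s x → :- (s :* x) := :- s :* x) refl (sign m 1#) x)

  sign-cong : ∀ m {x y} → x ≈ y → sign m x ≈ sign m y
  sign-cong zero    eq = eq
  sign-cong (suc m) eq = -‿cong (sign-cong m eq)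

  sign-0 : ∀ m → sign m 0# ≈ 0#
  sign-0 m = trans (sign-* m 0#) (zeroʳ _)

  minor : ∀ {n} → Fin (suc n) → Mat (suc n) → Mat n
  minor j A r c = A (suc r) (punchIn j c)

  det-cong : ∀ {n} {A B : Mat n} → A ≈M B → det A ≈ det B
  det-cong {zero}  eq = refl
  det-cong {suc n} eq = ∑-cong (suc n) (λ j → sign-cong (toℕ j) (*-cong (eq zero j) (det-cong (λ r c → eq (suc r) (punchIn j c)))))

  det-scalar : ∀ n a → det {n} (scalar a) ≈ pow a n
  det-scalar zero    a = refl
  det-scalar (suc n) a = begin
    a * det {n} (scalar a) + ∑ n _   ≈⟨ +-cong (*-congˡ (det-scalar n a))
        (trans (∑-cong n (λ j → trans (sign-cong (toℕ (suc j)) (zeroˡ (det (minor (suc j) (scalar a))))) (sign-0 (toℕ (suc j))))) (∑-0 n)) ⟩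
    a * pow a n + 0#                 ≈⟨ +-identityʳ _ ⟩
    a * pow a n                      ∎

  ∑-adjacent : ∀ {n} {a b : Fin n} (f : Fin n → Carrier) → Adjacent a b → f a + f b ≈ 0# →
    (∀ j → j ≢ a → j ≢ b → f j ≈ 0#) → ∑ n f ≈ 0#
  ∑-adjacent {suc (suc n)} f here fa+fb≈0 rest = begin
    f zero + (f (suc zero) + ∑ n (λ i → f (suc (suc i))))  ≈⟨ +-assoc _ _ _ ⟨
    f zero + f (suc zero) + ∑ n (λ i → f (suc (suc i)))    ≈⟨ +-cong fa+fb≈0 (trans (∑-cong n (λ i → rest (suc (suc i)) (λ ()) (λ ()))) (∑-0 n)) ⟩
    0# + 0#                                                ≈⟨ +-identityʳ _ ⟩
    0#                                                     ∎
  ∑-adjacent {suc n} f (there adj) fa+fb≈0 rest = trans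
    (+-cong (rest zero (λ ()) (λ ()))
      (∑-adjacent (f ∘ suc) adj fa+fb≈0 (λ j j≢a j≢b → rest (suc j) (j≢a ∘ Fin.suc-injective) (j≢b ∘ Fin.suc-injective))))
    (+-identityʳ _)

  punchIn-swap : ∀ {n} {a b : Fin (suc n)} (f : Fin (suc n) → Carrier) → Adjacent a b → f a ≈ f b →
    ∀ c → f (punchIn a c) ≈ f (punchIn b c)
  punchIn-swap f here fa≈fb zero            = sym fa≈fb
  punchIn-swap f here fa≈fb (suc c)         = refl
  punchIn-swap f (there adj) fa≈fb zero     = refl
  punchIn-swap {suc n} f (there adj) fa≈fb (suc c) = punchIn-swap (f ∘ suc) adj fa≈fb c

  -- In the expansion along row 0 the terms at `a` and `b` have equal entries and minors, with
  -- opposite signs because the columns are neighbours. Every other minor keeps both columns, still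
  -- adjacent. Antisymmetry alone would not give this in characteristic 2.
  det-alternating : ∀ {n} {a b : Fin n} (A : Mat n) → Adjacent a b → (∀ i → A i a ≈ A i b) → det A ≈ 0#
  det-alternating {suc n} {a} {b} A adj Aa≈Ab = ∑-adjacent term adj cancel rest
    where
    term : Fin (suc n) → Carrier
    term j = sign (toℕ j) (A zero j * det (minor j A))
    cancel : term a + term b ≈ 0#
    cancel = begin
      term a + term b   ≡⟨ ≡.cong (λ m → term a + sign m (A zero b * det (minor b A))) (toℕ-adjacent adj) ⟩
      term a - sign (toℕ a) (A zero b * det (minor b A))
        ≈⟨ +-congˡ (-‿cong (sign-cong (toℕ a) (*-cong (sym (Aa≈Ab zero)) (det-cong (λ r c → sym (punchIn-swap (A (suc r)) adj (Aa≈Ab (suc r)) c)))))) ⟩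
      term a - term a   ≈⟨ -‿inverseʳ _ ⟩
      0#                ∎
    rest : ∀ j → j ≢ a → j ≢ b → term j ≈ 0#
    rest j j≢a j≢b with punchIn-adjacent adj j
    ... | inj₁ j≡a = ⊥-elim (j≢a j≡a)
    ... | inj₂ (inj₁ j≡b) = ⊥-elim (j≢b j≡b)
    ... | inj₂ (inj₂ (a′ , b′ , adj′ , ≡.refl , ≡.refl)) =
      trans (sign-cong (toℕ j) (trans (*-congˡ (det-alternating (minor j A) adj′ (λ i → Aa≈Ab (suc i)))) (zeroʳ _))) (sign-0 (toℕ j))

  det-column-linear : ∀ {n} (b : Fin n) c (A B C : Mat n) → (∀ i → A i b ≈ B i b + c * C i b) →
    (∀ i j → j ≢ b → A i j ≈ B i j) → (∀ i j → j ≢ b → A i j ≈ C i j) → det A ≈ det B + c * det C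
  det-column-linear {suc n} b c A B C Ab A≈B A≈C = begin
    ∑ (suc n) (term A)                                     ≈⟨ ∑-cong (suc n) linear ⟩
    ∑ (suc n) (λ j → term B j + c * term C j)              ≈⟨ ∑-+ (suc n) (term B) (λ j → c * term C j) ⟩
    det B + ∑ (suc n) (λ j → c * term C j)                 ≈⟨ +-congˡ (∑-*ˡ (suc n) c (term C)) ⟩
    det B + c * det C                                      ∎
    where
    term : Mat (suc n) → Fin (suc n) → Carrier
    term M j = sign (toℕ j) (M zero j * det (minor j M))
    linear : ∀ j → term A j ≈ term B j + c * term C j
    linear j = trans (sign-cong (toℕ j) core) (begin
      sign (toℕ j) (y + c * z)                                  ≈⟨ sign-* (toℕ j) _ ⟩
      sign (toℕ j) 1# * (y + c * z)                             ≈⟨ solve 4 (λ s y c z → s :* (y :+ c :* z) := s :* y :+ c :* (s :* z)) refl (sign (toℕ j) 1#) y c z ⟩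
      sign (toℕ j) 1# * y + c * (sign (toℕ j) 1# * z)           ≈⟨ +-cong (sign-* (toℕ j) y) (*-congˡ (sign-* (toℕ j) z)) ⟨
      term B j + c * term C j                                   ∎)
      where
      y z : Carrier
      y = B zero j * det (minor j B)
      z = C zero j * det (minor j C)
      core : A zero j * det (minor j A) ≈ y + c * z
      core with j Fin.≟ b
      ... | yes ≡.refl = begin
        A zero j * det (minor j A)                            ≈⟨ *-congʳ (Ab zero) ⟩
        (B zero j + c * C zero j) * det (minor j A)           ≈⟨ solve 4 (λ x c y d → (x :+ c :* y) :* d := x :* d :+ c :* (y :* d)) refl (B zero j) c (C zero j) (det (minor j A)) ⟩
        B zero j * det (minor j A) + c * (C zero j * det (minor j A))
          ≈⟨ +-cong (*-congˡ (det-cong (λ r s → A≈B (suc r) _ (Fin.punchInᵢ≢i j s)))) (*-congˡ (*-congˡ (det-cong (λ r s → A≈C (suc r) _ (Fin.punchInᵢ≢i j s))))) ⟩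
        y + c * z                                             ∎
      ... | no j≢b = begin
        A zero j * det (minor j A)                            ≈⟨ *-congˡ (det-column-linear b′ c (minor j A) (minor j B) (minor j C) Ab′ (λ i s s≢b′ → A≈B (suc i) _ (away s s≢b′)) (λ i s s≢b′ → A≈C (suc i) _ (away s s≢b′))) ⟩
        A zero j * (det (minor j B) + c * det (minor j C))    ≈⟨ solve 4 (λ a x c y → a :* (x :+ c :* y) := a :* x :+ c :* (a :* y)) refl (A zero j) (det (minor j B)) c (det (minor j C)) ⟩
        A zero j * det (minor j B) + c * (A zero j * det (minor j C))
          ≈⟨ +-cong (*-congʳ (A≈B zero j j≢b)) (*-congˡ (*-congʳ (A≈C zero j j≢b))) ⟩
        y + c * z                                             ∎
        where
        b′ : Fin n
        b′ = Fin.punchOut j≢b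
        b≡ : punchIn j b′ ≡ b
        b≡ = Fin.punchIn-punchOut j≢b
        Ab′ : ∀ i → minor j A i b′ ≈ minor j B i b′ + c * minor j C i b′
        Ab′ i = ≡.subst (λ s → A (suc i) s ≈ B (suc i) s + c * C (suc i) s) (≡.sym b≡) (Ab (suc i))
        away : ∀ s → s ≢ b′ → punchIn j s ≢ b
        away s s≢b′ eq = s≢b′ (Fin.punchIn-injective j s b′ (≡.trans eq (≡.sym b≡)))

  addColumn : ∀ {n} → Fin n → Fin n → Carrier → Mat n → Mat n
  addColumn r s c A i j = A i j + A i r * (c * e s j)

  addColumn-target : ∀ {n} r (s : Fin n) c A i → addColumn r s c A i s ≈ A i s + c * A i r
  addColumn-target r s c A i = +-congˡ (trans (*-congˡ (trans (*-congˡ (e-diag s)) (*-identityʳ _))) (*-comm _ _))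

  addColumn-other : ∀ {n} r {s j : Fin n} c A i → j ≢ s → addColumn r s c A i j ≈ A i j
  addColumn-other r c A i j≢s = trans (+-congˡ (trans (*-congˡ (trans (*-congˡ (e-off (j≢s ∘ ≡.sym))) (zeroʳ _))) (zeroʳ _))) (+-identityʳ _)

  -- By linearity in column `s` the determinant changes by `c` times that of `A` with column `s`
  -- overwritten by column `r`, which has two equal neighbouring columns.
  det-addColumn : ∀ {n} {r s : Fin n} c A → Adjacent r s ⊎ Adjacent s r → det (addColumn r s c A) ≈ det A
  det-addColumn {n} {r} {s} c A adj = begin
    det (addColumn r s c A)   ≈⟨ det-column-linear s c (addColumn r s c A) A C
                                  (λ i → trans (addColumn-target r s c A i) (+-congˡ (*-congˡ (sym (C-target i)))))
                                  (λ i j → addColumn-other r c A i)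
                                  (λ i j j≢s → trans (addColumn-other r c A i j≢s) (sym (C-other i j j≢s))) ⟩
    det A + c * det C         ≈⟨ +-congˡ (trans (*-congˡ (C-vanishes adj)) (zeroʳ c)) ⟩
    det A + 0#                ≈⟨ +-identityʳ _ ⟩
    det A                     ∎
    where
    C : Mat n
    C i j with j Fin.≟ s
    ... | yes _ = A i r
    ... | no _  = A i j
    C-target : ∀ i → C i s ≈ A i r
    C-target i with s Fin.≟ s
    ... | yes _ = refl
    ... | no ne = ⊥-elim (ne ≡.refl)
    C-other : ∀ i j → j ≢ s → C i j ≈ A i j
    C-other i j j≢s with j Fin.≟ s
    ... | yes eq = ⊥-elim (j≢s eq)
    ... | no _ = refl
    C-vanishes : Adjacent r s ⊎ Adjacent s r → det C ≈ 0#
    C-vanishes (inj₁ adj) = det-alternating C adj (λ i → trans (C-other i r (adjacent-≢ adj)) (sym (C-target i)))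
    C-vanishes (inj₂ adj) = det-alternating C adj (λ i → trans (C-target i) (sym (C-other i r (adjacent-≢ adj ∘ ≡.sym))))

  addColumn-InGL : ∀ {n} {r s : Fin n} c A → s ≢ r → InGL (addColumn r s c A) → InGL A
  addColumn-InGL {n} {r} {s} c A s≢r (B , NB , BN) =
      t *M B
    , M.trans (M.sym (M.assoc A t B)) (M.trans (M.∙-congʳ (M.sym N≈At)) NB)
    , (M.trans (M.∙-congˡ {x = t *M B} (M.trans (insertʳ tt′ A) (M.∙-congʳ {x = t′} (M.sym N≈At))))
        (M.trans (M.assoc t B (N *M t′)) (M.trans (M.∙-congˡ {x = t} (M.trans (M.sym (M.assoc B N t′)) (M.trans (M.∙-congʳ {x = t′} BN) (M.identityˡ t′)))) tt′)))
    where
    module M = Monoid (*M-monoid n)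
    open import Algebra.Properties.Monoid (*M-monoid n) using (insertʳ)
    t t′ N : Mat n
    t  = T (e r) (c ⋆ e s)
    t′ = T (- 1# ⋆ e r) (c ⋆ e s)
    N  = addColumn r s c A
    tt′ : (t *M t′) ≈M I
    tt′ = proj₁ (transvection-inverse (e r) (c ⋆ e s) (trans (∙-e r (c ⋆ e s)) (trans (*-congˡ (e-off s≢r)) (zeroʳ c))))
    N≈At : N ≈M (A *M t)
    N≈At i j = sym (trans (◃-T (A i) (e r) (c ⋆ e s) j) (+-congˡ (*-congʳ (∙-e r (A i)))))

  module _ {n} {G : Mat (suc n) → Set} (G-col : ∀ {r s} c A → Adjacent r s ⊎ Adjacent s r → G (addColumn r s c A) → G A)
    (G₀ : ∀ A → (∀ j → A zero (suc j) ≈ 0#) → G A) where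

    -- Adjacent column operations suffice to clear row 0 from right to left.
    clear-row : ∀ m → m ℕ.≤ n → ∀ A → (∀ j → m ℕ.< toℕ j → A zero j ≈ 0#) → G A
    clear-row zero    _   A row0 = G₀ A (λ j → row0 (suc j) (s≤s z≤n))
    clear-row (suc m) m<n A row0 = split (A zero s ≈? 0#)
      where
      c : Fin n
      c = fromℕ< m<n
      r s : Fin (suc n)
      r = inject₁ c
      s = suc c
      adj : Adjacent r s
      adj = adjacent-inject₁ c
      toℕs : toℕ s ≡ suc m
      toℕs = ≡.cong suc (Fin.toℕ-fromℕ< m<n)
      toℕr : toℕ r ≡ m
      toℕr = ≡.trans (Fin.toℕ-inject₁ c) (Fin.toℕ-fromℕ< m<n)
      next : ∀ A → A zero s ≈ 0# → (∀ j → suc m ℕ.< toℕ j → A zero j ≈ 0#) → G A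
      next A A0s≈0 row0 = clear-row m (ℕ.<⇒≤ m<n) A λ j m<j → go j (ℕ.m≤n⇒m<n∨m≡n m<j)
        where
        go : ∀ j → suc m ℕ.< toℕ j ⊎ suc m ≡ toℕ j → A zero j ≈ 0#
        go j (inj₁ lt) = row0 j lt
        go j (inj₂ eq) = trans (reflexive (≡.cong (A zero) (Fin.toℕ-injective (≡.trans (≡.sym eq) (≡.sym toℕs))))) A0s≈0
      beyond-s : ∀ {j} → suc m ℕ.< toℕ j → j ≢ s
      beyond-s lt ≡.refl = ℕ.<-irrefl (≡.sym toℕs) lt
      beyond-r : ∀ {j} → suc m ℕ.< toℕ j → j ≢ r
      beyond-r lt ≡.refl = ℕ.<-irrefl (≡.sym toℕr) (ℕ.<-trans (ℕ.n<1+n m) lt)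
      unit-pivot : ∀ A → A zero r ≈ 1# → (∀ j → suc m ℕ.< toℕ j → A zero j ≈ 0#) → G A
      unit-pivot A A0r≈1 row0 = G-col (- A zero s) A (inj₁ adj) (next (addColumn r s (- A zero s) A)
        (begin
          addColumn r s (- A zero s) A zero s   ≈⟨ addColumn-target r s (- A zero s) A zero ⟩
          A zero s + - A zero s * A zero r      ≈⟨ +-congˡ (trans (*-congˡ A0r≈1) (*-identityʳ _)) ⟩
          A zero s - A zero s                   ≈⟨ -‿inverseʳ _ ⟩
          0#                                    ∎)
        (λ j lt → trans (addColumn-other r (- A zero s) A zero (beyond-s lt)) (row0 j lt)))
      split : Dec (A zero s ≈ 0#) → G A
      split (yes A0s≈0) = next A A0s≈0 row0
      -- Entry `r` may vanish, so the nonzero entry `s` first turns it into 1; column `r` then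
      -- clears entry `s`.
      split (no A0s≉0) =
        let (z , A0sz≈1) = inverse (A zero s) A0s≉0
            d = (1# - A zero r) * z
        in G-col d A (inj₂ adj) (unit-pivot (addColumn s r d A)
        (begin
          addColumn s r d A zero r                         ≈⟨ addColumn-target s r d A zero ⟩
          A zero r + (1# - A zero r) * z * A zero s        ≈⟨ solve 3 (λ a z b → a :+ (con (+ 1) :- a) :* z :* b := a :+ (con (+ 1) :- a) :* (b :* z)) refl (A zero r) z (A zero s) ⟩
          A zero r + (1# - A zero r) * (A zero s * z)      ≈⟨ +-congˡ (*-congˡ A0sz≈1) ⟩
          A zero r + (1# - A zero r) * 1#                  ≈⟨ solve 1 (λ a → a :+ (con (+ 1) :- a) :* con (+ 1) := con (+ 1)) refl (A zero r) ⟩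
          1#                                               ∎)
        (λ j lt → trans (addColumn-other s d A zero (beyond-r lt)) (row0 j lt)))

  block-InGL : ∀ {n} (A : Mat (suc n)) → (∀ j → A zero (suc j) ≈ 0#) → ¬ (A zero zero ≈ 0#) →
    InGL (minor zero A) → InGL A
  block-InGL {n} A row0 A₀₀≉0 (B′ , BB′ , B′B) = go (inverse _ A₀₀≉0)
    where
    B : Mat n
    B = minor zero A
    w : Vect n
    w i = A (suc i) zero
    go : (∃ λ z → A zero zero * z ≈ 1#) → InGL A
    go (z , dz≈1) = W , AW , WA
      where
      W : Mat (suc n)
      W zero    zero    = z
      W zero    (suc j) = 0#
      -- The lower left block of the inverse of a block triangular matrix: `B` times it has to
      -- cancel `w` times `z`.
      W (suc i) zero    = - z * (B′ ▹ w) i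
      W (suc i) (suc j) = B′ i j
      AW : (A *M W) ≈M I
      AW zero zero = trans (+-cong dz≈1 (trans (∑-cong n (λ r → trans (*-congʳ (row0 r)) (zeroˡ _))) (∑-0 n))) (+-identityʳ _)
      AW zero (suc j) = trans (+-cong (zeroʳ _) (trans (∑-cong n (λ r → trans (*-congʳ (row0 r)) (zeroˡ _))) (∑-0 n))) (+-identityʳ _)
      AW (suc i) zero = begin
        w i * z + (B ▹ (- z ⋆ (B′ ▹ w))) i     ≈⟨ +-congˡ (trans (▹-⋆ B (- z) (B′ ▹ w) i) (*-congˡ (▹-cancel w B B′ BB′ i))) ⟩
        w i * z + - z * w i                    ≈⟨ solve 2 (λ w z → w :* z :+ :- z :* w := con (+ 0)) refl (w i) z ⟩
        0#                                     ∎
      AW (suc i) (suc j) = trans (+-cong (zeroʳ _) (BB′ i j)) (+-identityˡ _)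
      WA : (W *M A) ≈M I
      WA zero zero = trans (+-cong (trans (*-comm _ _) dz≈1) (trans (∑-cong n (λ r → zeroˡ _)) (∑-0 n))) (+-identityʳ _)
      WA zero (suc j) = trans (+-cong (trans (*-congˡ (row0 j)) (zeroʳ _)) (trans (∑-cong n (λ r → zeroˡ _)) (∑-0 n))) (+-identityʳ _)
      WA (suc i) zero = begin
        - z * (B′ ▹ w) i * A zero zero + (B′ ▹ w) i   ≈⟨ solve 3 (λ z x d → :- z :* x :* d :+ x := x :- x :* (d :* z)) refl z ((B′ ▹ w) i) (A zero zero) ⟩
        (B′ ▹ w) i - (B′ ▹ w) i * (A zero zero * z)   ≈⟨ +-congˡ (-‿cong (trans (*-congˡ dz≈1) (*-identityʳ _))) ⟩
        (B′ ▹ w) i - (B′ ▹ w) i                       ≈⟨ -‿inverseʳ _ ⟩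
        0#                                            ∎
      WA (suc i) (suc j) = trans (+-cong (trans (*-congˡ (row0 j)) (zeroʳ _)) (B′B i j)) (+-identityˡ _)

  -- Serves to embed SL_n in GL_n, where an explicit inverse is demanded. Column operations preserve
  -- the determinant and reflect invertibility; once row 0 is cleared, the determinant is the corner
  -- times one minor, and induction applies.
  det≉0⇒InGL : ∀ {n} (A : Mat n) → ¬ (det A ≈ 0#) → InGL A
  det≉0⇒InGL {zero}  A _ = A , (λ ()) , (λ ())
  det≉0⇒InGL {suc n} A = clear-row {G = λ A → ¬ (det A ≈ 0#) → InGL A} column lower n ℕ.≤-refl A
      (λ j n<j → ⊥-elim (ℕ.<⇒≱ n<j (ℕ.≤-pred (Fin.toℕ<n j))))
    where
    column : ∀ {r s} c A → Adjacent r s ⊎ Adjacent s r → (¬ (det (addColumn r s c A) ≈ 0#) → InGL (addColumn r s c A)) →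
      ¬ (det A ≈ 0#) → InGL A
    column {r} {s} c A adj G ne = addColumn-InGL {r = r} {s} c A (λ { ≡.refl → [ (λ a → adjacent-≢ a ≡.refl) , (λ a → adjacent-≢ a ≡.refl) ] adj })
      (G (λ eq → ne (trans (sym (det-addColumn c A adj)) eq)))
    lower : ∀ A → (∀ j → A zero (suc j) ≈ 0#) → ¬ (det A ≈ 0#) → InGL A
    lower A row0 ne = block-InGL A row0
      (λ eq → ne (trans det≈ (trans (*-congʳ eq) (zeroˡ _))))
      (det≉0⇒InGL (minor zero A) (λ eq → ne (trans det≈ (trans (*-congˡ eq) (zeroʳ _)))))
      where
      det≈ : det A ≈ A zero zero * det (minor zero A)
      det≈ = trans (+-congˡ (trans (∑-cong n (λ j → trans (sign-cong (toℕ (suc j)) (trans (*-congʳ (row0 j)) (zeroˡ (det (minor (suc j) A))))) (sign-0 (toℕ (suc j))))) (∑-0 n))) (+-identityʳ _)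

-- Bézout coefficients and coprimality with prime powers

bézout : ∀ k e .{{_ : NonZero k}} .{{_ : NonZero e}} → ∃₂ λ u v → u ℕ.* k ≡ gcd k e ℕ.+ v ℕ.* e
bézout (suc k) (suc e) with Bézout.identity (gcd-GCD (suc k) (suc e))
... | Bézout.+- x y eq = x , y , ≡.sym eq
-- The coefficients must be natural, as they become exponents. With `K = suc k` and `E = suc e`,
-- here `d + x K = y E`; as `e` is -1 modulo `E`, the coefficient `x e` gives `d` modulo `E`, and
-- the extra `d E` keeps the cofactor of `E` nonnegative.
... | Bézout.-+ x y eq = x ℕ.* e ℕ.+ d ℕ.* suc e , y ℕ.* e ℕ.+ d ℕ.* k , (begin
  (x ℕ.* e ℕ.+ d ℕ.* suc e) ℕ.* suc k
    ≡⟨ solve 4 (λ x e d k → (x :* e :+ d :* (con 1 :+ e)) :* (con 1 :+ k) := d :+ e :* (d :+ x :* (con 1 :+ k)) :+ d :* k :* (con 1 :+ e)) ≡.refl x e d k ⟩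
  d ℕ.+ e ℕ.* (d ℕ.+ x ℕ.* suc k) ℕ.+ d ℕ.* k ℕ.* suc e
    ≡⟨ ≡.cong (λ z → d ℕ.+ e ℕ.* z ℕ.+ d ℕ.* k ℕ.* suc e) eq ⟩
  d ℕ.+ e ℕ.* (y ℕ.* suc e) ℕ.+ d ℕ.* k ℕ.* suc e
    ≡⟨ solve 4 (λ y e d k → d :+ e :* (y :* (con 1 :+ e)) :+ d :* k :* (con 1 :+ e) := d :+ (y :* e :+ d :* k) :* (con 1 :+ e)) ≡.refl y e d k ⟩
  d ℕ.+ (y ℕ.* e ℕ.+ d ℕ.* k) ℕ.* suc e ∎)
  where
  d = gcd (suc k) (suc e)
  open Data.Nat.Solver.+-*-Solver
  open ≡.≡-Reasoning

coprime-^ : ∀ {p k} → Prime p → ¬ (p ∣ k) → ∀ n → Coprime k (p ^ n)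
coprime-^ pr p∤k zero    (_ , d∣1) = ∣1⇒≡1 d∣1
coprime-^ {p} {k} pr p∤k (suc n) {d} (d∣k , d∣p^) = coprime-^ pr p∤k n (d∣k , coprime-divisor d-p d∣p^)
  where
  d-p : Coprime d p
  d-p (c∣d , c∣p) with prime⇒irreducible pr c∣p
  ... | inj₁ c≡1 = c≡1
  ... | inj₂ ≡.refl = ⊥-elim (p∤k (∣-trans c∣d d∣k))

-- The characteristic, and Fermat's little theorem

module Characteristic {q : ℕ} (F : FiniteField q) where
  open FiniteField F hiding (zero)
  open Matrices F
  open LinearAlgebra F
  open import Algebra.Properties.Semiring.Sum semiring using (sum; sum-cong-≋; ∑-distrib-+; sum-permute; sum-replicate)
  open import Algebra.Properties.Semiring.Mult semiring using (×1-homo-*; ×-comm-*; ×-congʳ)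
  open import Algebra.Properties.Semiring.Mult semiring public using () renaming (_×_ to _·_)
  open import Relation.Binary.Reasoning.Setoid setoid

  enum-permutation : (f f⁻¹ : Carrier → Carrier) → (∀ {x y} → x ≈ y → f x ≈ f y) → (∀ {x y} → x ≈ y → f⁻¹ x ≈ f⁻¹ y) →
    (∀ x → f (f⁻¹ x) ≈ x) → (∀ x → f⁻¹ (f x) ≈ x) → Permutation q q
  enum-permutation f f⁻¹ f-cong f⁻¹-cong ff⁻¹ f⁻¹f = permutation (λ i → index (f (enum i))) (λ i → index (f⁻¹ (enum i)))
    (λ i → enum-injective _ _ (trans (enum-index _) (trans (f-cong (enum-index _)) (ff⁻¹ (enum i)))))
    (λ i → enum-injective _ _ (trans (enum-index _) (trans (f⁻¹-cong (enum-index _)) (f⁻¹f (enum i)))))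

  -- Translation by 1 permutes the elements, so it does not change their sum.
  q·1≈0 : q · 1# ≈ 0#
  q·1≈0 = begin
    q · 1#                        ≈⟨ solve 2 (λ s x → x := (s :+ x) :- s) refl (sum enum) (q · 1#) ⟩
    (sum enum + q · 1#) - sum enum    ≈⟨ +-congʳ (trans (+-congˡ (sym (sum-replicate q))) (sym (∑-distrib-+ enum (λ _ → 1#)))) ⟩
    sum (λ i → enum i + 1#) - sum enum    ≈⟨ +-congʳ (sum-cong-≋ {q} (λ i → sym (enum-index (enum i + 1#)))) ⟩
    sum (λ i → enum (π ⟨$⟩ʳ i)) - sum enum    ≈⟨ +-congʳ (sum-permute enum π) ⟨
    sum enum - sum enum           ≈⟨ -‿inverseʳ _ ⟩
    0#                            ∎
    where
    π : Permutation q q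
    π = enum-permutation (_+ 1#) (_- 1#) +-congʳ +-congʳ
      (solve 1 (λ x → (x :- con (+ 1)) :+ con (+ 1) := x) refl)
      (solve 1 (λ x → (x :+ con (+ 1)) :- con (+ 1) := x) refl)

  -- `p ^ l · 1#` is the `l`-th power of `p · 1#`, and a field has no zero divisors.
  p^l·1≈0⇒p·1≈0 : ∀ p l → (p ^ l) · 1# ≈ 0# → p · 1# ≈ 0#
  p^l·1≈0⇒p·1≈0 p zero    eq = ⊥-elim (1≉0 (trans (sym (+-identityʳ 1#)) eq))
  p^l·1≈0⇒p·1≈0 p (suc l) eq with p · 1# ≈? 0#
  ... | yes p·1≈0 = p·1≈0
  ... | no p·1≉0 = p^l·1≈0⇒p·1≈0 p l (*-cancel-0 p·1≉0 (trans (sym (×1-homo-* p (p ^ l))) eq))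

  p·x≈0 : ∀ p → p · 1# ≈ 0# → ∀ x → p · x ≈ 0#
  p·x≈0 p eq x = begin
    p · x           ≈⟨ ×-congʳ p (*-identityʳ x) ⟨
    p · (x * 1#)    ≈⟨ ×-comm-* p x 1# ⟨
    x * (p · 1#)    ≈⟨ *-congˡ eq ⟩
    x * 0#          ≈⟨ zeroʳ x ⟩
    0#              ∎

  pow-cong : ∀ {x y} m → x ≈ y → pow x m ≈ pow y m
  pow-cong zero    eq = refl
  pow-cong (suc m) eq = *-cong eq (pow-cong m eq)

  pow-+ : ∀ x m n → pow x (m ℕ.+ n) ≈ pow x m * pow x n
  pow-+ x zero    n = sym (*-identityˡ _)
  pow-+ x (suc m) n = trans (*-congˡ (pow-+ x m n)) (sym (*-assoc _ _ _))

  pow-* : ∀ x m n → pow x (m ℕ.* n) ≈ pow (pow x n) m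
  pow-* x zero    n = refl
  pow-* x (suc m) n = trans (pow-+ x n (m ℕ.* n)) (*-congˡ (pow-* x m n))

  pow-1 : ∀ m → pow 1# m ≈ 1#
  pow-1 zero    = refl
  pow-1 (suc m) = trans (*-identityˡ _) (pow-1 m)

module Fermat {m : ℕ} (F : FiniteField (suc m)) where
  open FiniteField F hiding (zero)
  open Matrices F
  open LinearAlgebra F
  open Characteristic F
  open import Algebra.Properties.CommutativeMonoid.Sum *-commutativeMonoid using () renaming (sum to ∏; sum-cong-≋ to ∏-cong; ∑-distrib-+ to ∏-distrib; sum-permute to ∏-permute)
  open import Relation.Binary.Reasoning.Setoid setoid

  ∏≉0 : ∀ {n} (f : Fin n → Carrier) → (∀ i → ¬ (f i ≈ 0#)) → ¬ (∏ f ≈ 0#)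
  ∏≉0 {zero}  f ne eq = 1≉0 eq
  ∏≉0 {suc n} f ne eq = ∏≉0 (f ∘ suc) (ne ∘ suc) (*-cancel-0 (ne zero) eq)

  ∏-constant : ∀ n x → ∏ {n} (λ _ → x) ≈ pow x n
  ∏-constant zero    x = refl
  ∏-constant (suc n) x = *-congˡ (∏-constant n x)

  -- Multiplication by x permutes the non-zero elements, so it does not change their product.
  fermat : ∀ {x} → ¬ (x ≈ 0#) → pow x m ≈ 1#
  fermat {x} x≉0 = go (inverse x x≉0)
    where
    i₀ : Fin (suc m)
    i₀ = index 0#
    y : Fin m → Carrier
    y j = enum (punchIn i₀ j)
    y≉0 : ∀ j → ¬ (y j ≈ 0#)
    y≉0 j eq = Fin.punchInᵢ≢i i₀ j (enum-injective _ _ (trans eq (sym (enum-index 0#))))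
    go : (∃ λ z → x * z ≈ 1#) → pow x m ≈ 1#
    go (z , xz≈1) = x-y≈0⇒x≈y (*-cancel-0 (∏≉0 y y≉0) (begin
        ∏ y * (pow x m - 1#)          ≈⟨ solve 2 (λ p x → p :* (x :- con (+ 1)) := x :* p :- p) refl (∏ y) (pow x m) ⟩
        pow x m * ∏ y - ∏ y           ≈⟨ +-congʳ (*-congʳ (∏-constant m x)) ⟨
        ∏ {m} (λ _ → x) * ∏ y - ∏ y   ≈⟨ +-congʳ (∏-distrib {m} (λ _ → x) y) ⟨
        ∏ (λ j → x * y j) - ∏ y       ≈⟨ +-congʳ (∏-cong {m} permuted) ⟩
        ∏ (λ j → y (ρ ⟨$⟩ʳ j)) - ∏ y  ≈⟨ +-congʳ (∏-permute y ρ) ⟨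
        ∏ y - ∏ y                     ≈⟨ -‿inverseʳ _ ⟩
        0#                            ∎))
      where
      cancel : ∀ a b → a * b ≈ 1# → ∀ w → a * (b * w) ≈ w
      cancel a b ab≈1 w = trans (sym (*-assoc a b w)) (trans (*-congʳ ab≈1) (*-identityˡ w))
      π : Permutation (suc m) (suc m)
      π = enum-permutation (x *_) (z *_) *-congˡ *-congˡ (cancel x z xz≈1) (cancel z x (trans (*-comm z x) xz≈1))
      πi₀≡i₀ : π ⟨$⟩ʳ i₀ ≡ i₀
      πi₀≡i₀ = enum-injective _ _ (trans (enum-index _) (trans (*-congˡ (enum-index 0#)) (trans (zeroʳ x) (sym (enum-index 0#)))))
      -- `π` fixes the index of zero, so removing that index leaves a permutation of the nonzero
      -- elements.
      ρ : Permutation m m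
      ρ = remove i₀ π
      permuted : ∀ j → x * y j ≈ y (ρ ⟨$⟩ʳ j)
      permuted j = begin
        x * y j                                         ≈⟨ enum-index (x * y j) ⟨
        enum (π ⟨$⟩ʳ punchIn i₀ j)                      ≡⟨ ≡.cong enum (punchIn-permute π i₀ j) ⟩
        enum (punchIn (π ⟨$⟩ʳ i₀) (ρ ⟨$⟩ʳ j))           ≡⟨ ≡.cong (λ i → enum (punchIn i (ρ ⟨$⟩ʳ j))) πi₀≡i₀ ⟩
        y (ρ ⟨$⟩ʳ j)                                    ∎

  -- x ^ gcd(k, q-1) is a k-th power because x ^ (q-1) = 1.
  gcd-power⇒k-power : ∀ k .{{_ : NonZero k}} {x} → ¬ (x ≈ 0#) → ∃ λ y → pow y k ≈ pow x (gcd k m)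
  gcd-power⇒k-power k {x} x≉0 = go m (fermat x≉0)
    where
    go : ∀ e → pow x e ≈ 1# → ∃ λ y → pow y k ≈ pow x (gcd k e)
    -- Bézout asks for a positive exponent; for exponent 0 the gcd is `k` itself and `x` is the
    -- root.
    go zero    _ = x , reflexive (≡.cong (pow x) (≡.sym (gcd-identityʳ k)))
    go (suc e) eq =
      let (u , v , uk≡) = bézout k (suc e) in pow x u , (begin
        pow (pow x u) k                               ≈⟨ pow-* x k u ⟨
        pow x (k ℕ.* u)                               ≡⟨ ≡.cong (pow x) (≡.trans (ℕ.*-comm k u) uk≡) ⟩
        pow x (gcd k (suc e) ℕ.+ v ℕ.* suc e)         ≈⟨ pow-+ x (gcd k (suc e)) (v ℕ.* suc e) ⟩
        pow x (gcd k (suc e)) * pow x (v ℕ.* suc e)   ≈⟨ *-congˡ (trans (pow-* x v (suc e)) (trans (pow-cong v eq) (pow-1 v))) ⟩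
        pow x (gcd k (suc e)) * 1#                    ≈⟨ *-identityʳ _ ⟩
        pow x (gcd k (suc e))                         ∎)

-- Matrix powers and roots of unitriangular matrices

module MatrixPowers {q : ℕ} (F : FiniteField q) where
  open FiniteField F hiding (zero)
  open Matrices F
  open LinearAlgebra F
  open Reduction F using (Idempotent)
  open Characteristic F
  open import Relation.Binary.Reasoning.Setoid setoid

  module _ {n : ℕ} where
    private module M = Monoid (*M-monoid n)
    open import Algebra.Properties.Monoid.Mult (*M-monoid n) using (×-congʳ; ×-homo-+; ×-assocˡ; ×-idem) renaming (_×_ to _∗_)
    open Conjugation (*M-monoid n)
    open import Relation.Binary.Reasoning.Setoid M.setoid as MR using ()

    ^M≡ : ∀ (A : Mat n) m → A ^M m ≡ m ∗ A
    ^M≡ A zero    = ≡.refl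
    ^M≡ A (suc m) = ≡.cong (A *M_) (^M≡ A m)

    ^M-cong : ∀ {A B : Mat n} m → A ≈M B → (A ^M m) ≈M (B ^M m)
    ^M-cong {A} {B} m eq rewrite ^M≡ A m | ^M≡ B m = ×-congʳ m eq

    ^M-+ : ∀ (A : Mat n) k m → (A ^M (k ℕ.+ m)) ≈M ((A ^M k) *M (A ^M m))
    ^M-+ A k m rewrite ^M≡ A (k ℕ.+ m) | ^M≡ A k | ^M≡ A m = ×-homo-+ A k m

    ^M-* : ∀ (A : Mat n) k m → ((A ^M m) ^M k) ≈M (A ^M (k ℕ.* m))
    ^M-* A k m rewrite ^M≡ (A ^M m) k | ^M≡ A m | ^M≡ A (k ℕ.* m) = ×-assocˡ A k m

    ^M-idempotent : ∀ {E : Mat n} → Idempotent E → ∀ k .{{_ : NonZero k}} → (E ^M k) ≈M E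
    ^M-idempotent {E} EE k rewrite ^M≡ E k = ×-idem EE k

    I-^M : ∀ m → (I {n} ^M m) ≈M I
    I-^M zero    = M.refl
    I-^M (suc m) = M.trans (M.identityˡ (I ^M m)) (I-^M m)

    ^M-suc : ∀ (A : Mat n) m → (A ^M suc m) ≈M ((A ^M m) *M A)
    ^M-suc A m = MR.begin
      A ^M suc m               MR.≡⟨ ≡.cong (A ^M_) (ℕ.+-comm 1 m) ⟩
      A ^M (m ℕ.+ 1)           MR.≈⟨ ^M-+ A m 1 ⟩
      (A ^M m) *M (A *M I)     MR.≈⟨ M.∙-congˡ {x = A ^M m} (M.identityʳ A) ⟩
      (A ^M m) *M A            MR.∎

    conj-^M : ∀ (c c′ : Mat n) → (c *M c′) ≈M I → (c′ *M c) ≈M I → ∀ A m → (((c *M A) *M c′) ^M m) ≈M ((c *M (A ^M m)) *M c′)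
    conj-^M c c′ cc′ c′c A zero    = M.sym (conj-ε cc′)
    conj-^M c c′ cc′ c′c A (suc m) = M.trans (M.∙-congˡ {x = (c *M A) *M c′} (conj-^M c c′ cc′ c′c A m)) (conj-∙ c′c A (A ^M m))

    finite-order⇒InGL : ∀ (A : Mat n) k .{{_ : NonZero k}} → (A ^M k) ≈M I → InGL A
    finite-order⇒InGL A (suc k) eq = A ^M k , eq , M.trans (M.sym (^M-suc A k)) eq

    -- With `u k = 1 + v e`, the power `U ^ u` is a `k`-th root because `U ^ (v e) = I`. It is
    -- invertible since its own `e`-th power is `I`.
    coprime-order⇒root : ∀ (U : Mat n) k e .{{_ : NonZero k}} .{{_ : NonZero e}} → gcd k e ≡ 1 → (U ^M e) ≈M I →
      ∃ λ A → InGL A × ((A ^M k) ≈M U)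
    coprime-order⇒root U k e gcd≡1 Ue≈I =
      let (u , v , uk≡) = bézout k e
          Ue-multiple : ∀ w → (U ^M (w ℕ.* e)) ≈M I
          Ue-multiple w = M.trans (M.sym (^M-* U w e)) (M.trans (^M-cong w Ue≈I) (I-^M w))
      in U ^M u
      , finite-order⇒InGL (U ^M u) e
          (M.trans (^M-* U e u) (M.trans (M.reflexive (≡.cong (U ^M_) (ℕ.*-comm e u))) (Ue-multiple u)))
      , (MR.begin
          (U ^M u) ^M k                 MR.≈⟨ ^M-* U k u ⟩
          U ^M (k ℕ.* u)                MR.≡⟨ ≡.cong (U ^M_) (≡.trans (ℕ.*-comm k u) (≡.trans uk≡ (≡.cong (ℕ._+ v ℕ.* e) gcd≡1))) ⟩
          U *M (U ^M (v ℕ.* e))         MR.≈⟨ M.∙-congˡ {x = U} (Ue-multiple v) ⟩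
          U *M I                        MR.≈⟨ M.identityʳ U ⟩
          U                             MR.∎)

    ᵀ-^M : ∀ (A : Mat n) m → ((A ᵀ) ^M m) ≈M ((A ^M m) ᵀ)
    ᵀ-^M A zero    i j = reflexive (e-sym i j)
    ᵀ-^M A (suc m) = MR.begin
      (A ᵀ) ^M suc m            MR.≈⟨ ^M-suc (A ᵀ) m ⟩
      ((A ᵀ) ^M m) *M (A ᵀ)     MR.≈⟨ M.∙-congʳ {x = A ᵀ} (ᵀ-^M A m) ⟩
      ((A ^M m) ᵀ) *M (A ᵀ)     MR.≈⟨ *M-ᵀ A (A ^M m) ⟨
      (A *M (A ^M m)) ᵀ         MR.∎

    ᵀ-InGL : ∀ {A : Mat n} → InGL A → InGL (A ᵀ)
    ᵀ-InGL {A} (B , AB , BA) = B ᵀ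
      , M.trans (M.sym (*M-ᵀ B A)) (λ i j → trans (BA j i) (reflexive (e-sym j i)))
      , M.trans (M.sym (*M-ᵀ A B)) (λ i j → trans (AB j i) (reflexive (e-sym j i)))

  scalar-cong : ∀ {n a b} → a ≈ b → scalar {n} a ≈M scalar b
  scalar-cong eq zero    zero    = eq
  scalar-cong eq zero    (suc j) = refl
  scalar-cong eq (suc i) zero    = refl
  scalar-cong eq (suc i) (suc j) = scalar-cong eq i j

  scalar-+≈0 : ∀ {n a b} → a + b ≈ 0# → (scalar {n} a +M scalar b) ≈M 0M
  scalar-+≈0 eq zero    zero    = eq
  scalar-+≈0 eq zero    (suc j) = +-identityʳ _
  scalar-+≈0 eq (suc i) zero    = +-identityʳ _
  scalar-+≈0 eq (suc i) (suc j) = scalar-+≈0 eq i j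

  scalar-*M : ∀ {n} a b → (scalar {n} a *M scalar b) ≈M scalar (a * b)
  scalar-*M {suc n} a b zero    zero    = trans (+-congˡ (trans (∑-cong n (λ r → zeroˡ 0#)) (∑-0 n))) (+-identityʳ _)
  scalar-*M {suc n} a b zero    (suc j) = trans (+-cong (zeroʳ a) (trans (∑-cong n (λ r → zeroˡ _)) (∑-0 n))) (+-identityʳ _)
  scalar-*M {suc n} a b (suc i) zero    = trans (+-cong (zeroˡ b) (trans (∑-cong n (λ r → zeroʳ _)) (∑-0 n))) (+-identityʳ _)
  scalar-*M {suc n} a b (suc i) (suc j) = trans (+-congʳ (zeroˡ 0#)) (trans (+-identityˡ _) (scalar-*M a b i j))

  scalar-^M : ∀ {n} a m → (scalar {n} a ^M m) ≈M scalar (pow a m)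
  scalar-^M a zero    = ≈M-refl
  scalar-^M a (suc m) = ≈M-trans (*M-cong {A = scalar a} ≈M-refl (scalar-^M a m)) (scalar-*M a (pow a m))

  scalar-InGL : ∀ {n a} → ¬ (a ≈ 0#) → InGL (scalar {n} a)
  scalar-InGL {n} {a} a≉0 = let (z , az≈1) = inverse a a≉0 in scalar z
    , ≈M-trans (scalar-*M a z) (scalar-cong az≈1)
    , ≈M-trans (scalar-*M z a) (scalar-cong (trans (*-comm z a) az≈1))

  bordered : ∀ {n} → Vect n → Mat n → Mat (suc n)
  bordered w A zero    zero    = 1#
  bordered w A zero    (suc j) = w j
  bordered w A (suc i) zero    = 0#
  bordered w A (suc i) (suc j) = A i j

  bordered-cong : ∀ {n} {w v : Vect n} {A B : Mat n} → w ≈V v → A ≈M B → bordered w A ≈M bordered v B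
  bordered-cong eq eq′ zero    zero    = refl
  bordered-cong eq eq′ zero    (suc j) = eq j
  bordered-cong eq eq′ (suc i) zero    = refl
  bordered-cong eq eq′ (suc i) (suc j) = eq′ i j

  I≈bordered : ∀ {n} → I {suc n} ≈M bordered (λ _ → 0#) I
  I≈bordered zero    zero    = refl
  I≈bordered zero    (suc j) = refl
  I≈bordered (suc i) zero    = refl
  I≈bordered (suc i) (suc j) = refl

  bordered-*M : ∀ {n} (w v : Vect n) (A B : Mat n) → (bordered w A *M bordered v B) ≈M bordered (v +V (w ◃ B)) (A *M B)
  bordered-*M {n} w v A B zero    zero    = trans (+-cong (*-identityʳ _) (trans (∑-cong n (λ r → zeroʳ _)) (∑-0 n))) (+-identityʳ _)
  bordered-*M w v A B zero    (suc j) = +-congʳ (*-identityˡ _)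
  bordered-*M {n} w v A B (suc i) zero    = trans (+-cong (zeroˡ _) (trans (∑-cong n (λ r → zeroʳ _)) (∑-0 n))) (+-identityʳ _)
  bordered-*M w v A B (suc i) (suc j) = trans (+-congʳ (zeroˡ _)) (+-identityˡ _)

  -- The border is left unspecified, because a further `p`-th power will annihilate it whatever it
  -- is.
  bordered-^M : ∀ {n} (w : Vect n) (A : Mat n) m → ∃ λ w′ → (bordered w A ^M m) ≈M bordered w′ (A ^M m)
  bordered-^M w A zero    = (λ _ → 0#) , I≈bordered
  bordered-^M w A (suc m) = let (w′ , eq) = bordered-^M w A m in
    w′ +V (w ◃ (A ^M m)) , ≈M-trans (*M-cong {A = bordered w A} ≈M-refl eq) (bordered-*M w w′ A (A ^M m))

  bordered-I-^M : ∀ {n} (w : Vect n) m → (bordered w I ^M m) ≈M bordered (λ j → m · w j) I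
  bordered-I-^M w zero    = I≈bordered
  bordered-I-^M {n} w (suc m) = ≈M-trans (*M-cong {A = bordered w I} ≈M-refl (bordered-I-^M w m))
    (≈M-trans (bordered-*M w (λ j → m · w j) I I)
      (bordered-cong (λ j → trans (+-congˡ (◃-I w j)) (+-comm _ _)) (Monoid.identityˡ (*M-monoid n) I)))

  upper : ∀ {n} → Mat n → Mat n
  upper {zero}  M = M
  upper {suc n} M = bordered (λ j → M zero (suc j)) (upper (λ i j → M (suc i) (suc j)))

  -- By induction the `p ^ n`-th power has the identity as its lower block. Powers of such a matrix
  -- only multiply the border, so a `p`-th power turns it into `p · w′`, which vanishes.
  upper-order : ∀ {n} p → p · 1# ≈ 0# → (M : Mat n) → (upper M ^M (p ^ n)) ≈M I
  upper-order {zero}  p p·1≈0 M ()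
  upper-order {suc n} p p·1≈0 M =
    let w = λ j → M zero (suc j)
        U = upper (λ i j → M (suc i) (suc j))
        (w′ , eq) = bordered-^M w U (p ^ n)
    in ≈M-trans (≈M-sym (^M-* (upper M) p (p ^ n)))
      (≈M-trans (^M-cong p (≈M-trans eq (bordered-cong {w = w′} (λ _ → refl) (upper-order p p·1≈0 (λ i j → M (suc i) (suc j))))))
        (≈M-trans (bordered-I-^M w′ p)
          (≈M-trans (bordered-cong {B = I} (λ j → p·x≈0 p p·1≈0 (w′ j)) ≈M-refl) (≈M-sym I≈bordered))))

  -- `upper` writes 1 on the diagonal whatever `M` has there, so the two triangular halves meet in 1
  -- + 1. In characteristic 2 this means a zero diagonal, and the argument is the same.
  upper+lower : ∀ {n} (M : Mat n) → (∀ i → M i i ≈ 1# + 1#) → (upper M +M (upper (M ᵀ) ᵀ)) ≈M M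
  upper+lower {suc n} M diag zero    zero    = sym (diag zero)
  upper+lower {suc n} M diag zero    (suc j) = +-identityʳ _
  upper+lower {suc n} M diag (suc i) zero    = +-identityˡ _
  upper+lower {suc n} M diag (suc i) (suc j) = upper+lower (λ i j → M (suc i) (suc j)) (λ i → diag (suc i)) i j

  -- The lower half is the transpose of an `upper` matrix and transposition commutes with powers, so
  -- one root construction serves both halves.
  diagonal-2⇒Q : ∀ {n} p k .{{_ : NonZero k}} → Prime p → ¬ (p ∣ k) → p · 1# ≈ 0# →
    (M : Mat n) → (∀ i → M i i ≈ 1# + 1#) → Q k n M
  diagonal-2⇒Q {n} p k pr p∤k p·1≈0 M diag =
    let (A , A-GL , Ak) = root (upper M) (upper-order p p·1≈0 M)
        (B , B-GL , Bk) = root (upper (M ᵀ)) (upper-order p p·1≈0 (M ᵀ))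
    in A , B ᵀ , A-GL , ᵀ-InGL B-GL
      , λ i j → trans (+-cong (Ak i j) (trans (ᵀ-^M B k i j) (Bk j i))) (upper+lower M diag i j)
    where
    instance
      p-nonZero = prime⇒nonZero pr
      p^n-nonZero = ℕ.m^n≢0 p n
    root : ∀ U → (U ^M (p ^ n)) ≈M I → ∃ λ A → InGL A × ((A ^M k) ≈M U)
    root U = coprime-order⇒root U k (p ^ n) (coprime⇒gcd≡1 (coprime-^ pr p∤k n))

-- Application to sums of two k-th powers

q≥4 : ∀ {q} → FiniteField q → ¬ (q ≡ 2) → ¬ (q ≡ 3) → 4 ℕ.≤ q
q≥4 {zero} F _ _ with () ← proj₁ (FiniteField.enum-surjective F (FiniteField.0# F))
q≥4 {suc zero} F _ _ = ⊥-elim (1≉0 (trans (sym (proj₂ (enum-surjective 1#)))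
    (trans (reflexive (≡.cong enum (Fin1 _ _))) (proj₂ (enum-surjective 0#)))))
  where
  open FiniteField F hiding (zero)
  Fin1 : (i j : Fin 1) → i ≡ j
  Fin1 zero zero = ≡.refl
q≥4 {suc (suc zero)} F q≢2 _ = ⊥-elim (q≢2 ≡.refl)
q≥4 {suc (suc (suc zero))} F _ q≢3 = ⊥-elim (q≢3 ≡.refl)
q≥4 {suc (suc (suc (suc q)))} F _ _ = s≤s (s≤s (s≤s (s≤s z≤n)))

module PowerSums {q : ℕ} (F : FiniteField q) where
  open FiniteField F hiding (zero)
  open Matrices F
  open LinearAlgebra F
  open Transvections F
  open NormalSubgroups F
  open Reduction F
  open Determinants F
  open Characteristic F
  open MatrixPowers F

  module _ {n : ℕ} where
    private module M = Monoid (*M-monoid n)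
    open import Algebra.Properties.Monoid (*M-monoid n) using (cancelˡ)

    conj-sum : ∀ (c c′ A B : Mat n) k → (c *M c′) ≈M I → (c′ *M c) ≈M I →
      ((((c *M A) *M c′) ^M k) +M (((c *M B) *M c′) ^M k)) ≈M ((c *M ((A ^M k) +M (B ^M k))) *M c′)
    conj-sum c c′ A B k cc′ c′c = M.trans
      (λ i j → +-cong (conj-^M c c′ cc′ c′c A k i j) (conj-^M c c′ cc′ c′c B k i j))
      (M.sym (M.trans (M.∙-congʳ {x = c′} (*M-distribˡ c (A ^M k) (B ^M k))) (*M-distribʳ c′ (c *M (A ^M k)) (c *M (B ^M k)))))

    P-invariant : ∀ k → ConjugationInvariant (P k n)
    P-invariant k = record
      { S-resp = λ eq (A , B , sum≈) → A , B , M.trans sum≈ eq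
      ; S-conj = λ {_} {c} {c′} cc′ c′c (A , B , sum≈) → (c *M A) *M c′ , (c *M B) *M c′
          , M.trans (conj-sum c c′ A B k cc′ c′c) (M.∙-congʳ {x = c′} (M.∙-congˡ {x = c} sum≈)) }

    Q-invariant : ∀ k → ConjugationInvariant (Q k n)
    Q-invariant k = record
      { S-resp = λ eq (A , B , A-GL , B-GL , sum≈) → A , B , A-GL , B-GL , M.trans sum≈ eq
      ; S-conj = λ {_} {c} {c′} cc′ c′c (A , B , A-GL , B-GL , sum≈) → (c *M A) *M c′ , (c *M B) *M c′
          , conj-InGL cc′ c′c A-GL , conj-InGL cc′ c′c B-GL
          , M.trans (conj-sum c c′ A B k cc′ c′c) (M.∙-congʳ {x = c′} (M.∙-congˡ {x = c} sum≈)) }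

    InSL⇒InGL : ∀ {g : Mat n} → InSL g → InGL g
    InSL⇒InGL {g} det≈1 = det≉0⇒InGL g (λ det≈0 → 1≉0 (trans (sym det≈1) det≈0))

    IsAll⇒InL : ∀ {S : Mat n → Set} {g} → InGL g → IsAll S → InL S g
    IsAll⇒InL (g′ , gg′ , g′g) all =
      (g′ , gg′ , g′g) , (λ s _ → all _) , (λ t _ → g′ *M t , all _ , cancelˡ gg′ t)

    *M-0M : ∀ (A : Mat n) → (A *M 0M) ≈M 0M
    *M-0M A i j = trans (∑-cong n (λ r → zeroʳ (A i r))) (∑-0 n)

    -- If g s = 0 then s = 0, so s ∈ S gives 0 ∈ S.
    IsAllWithZero⇒InL : ∀ {S : Mat n → Set} → ConjugationInvariant S → ∀ {g} → InGL g → IsAllWithZero S → InL S g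
    IsAllWithZero⇒InL {S} C (g′ , gg′ , g′g) all = (g′ , gg′ , g′g) , into gg′ g′g
      , (λ t St → g′ *M t , into g′g gg′ t St , cancelˡ gg′ t)
      where
      open ConjugationInvariant C
      into : ∀ {a a′} → (a *M a′) ≈M I → (a′ *M a) ≈M I → ∀ s → S s → S (a *M s)
      into {a} {a′} _ a′a s Ss = choose (all (a *M s))
        where
        choose : S (a *M s) ⊎ ((a *M s) ≈M 0M) → S (a *M s)
        choose (inj₁ Sas) = Sas
        choose (inj₂ as≈0) = S-resp (M.trans (M.sym (cancelˡ a′a s))
          (M.trans (M.∙-congˡ {x = a′} as≈0) (M.trans (*M-0M a′) (M.sym as≈0)))) Ss

    InL⇒Closed : ∀ {S : Mat n → Set} → ConjugationInvariant S → n ≥ 2 → (n ≡ 2 → 4 ℕ.≤ q) →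
      ∀ {g} → InSL g → ¬ InZ n g → InL S g → Closed S
    InL⇒Closed C n≥2 big {g} det≈1 g∉Z Lg = transvections⇒Closed C
      -- A scalar matrix with entry `a` has determinant `a ^ n`; with determinant 1 it would lie in
      -- `Z`.
      (non-scalar⇒all-transvections (InL-normal C) n≥2 big Lg λ (a , g≈a) →
        g∉Z (a , trans (sym (det-scalar n a)) (trans (sym (det-cong g≈a)) det≈1) , g≈a))

  -- An idempotent is its own `k`-th power for `k ≥ 1`, so every sum of two idempotents lies in `P`,
  -- whether or not the characteristic divides `k`.
  Closed⇒P-all : ∀ {n} k .{{_ : NonZero k}} → n ≥ 2 → Closed (P k n) → IsAll (P k n)
  Closed⇒P-all {suc (suc n)} k n≥2 C = idempotent-sums n C λ E E′ EE E′E′ →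
    E , E′ , λ i j → +-cong (^M-idempotent EE k i j) (^M-idempotent E′E′ k i j)
  Closed⇒P-all {suc zero} k (s≤s ()) C

  Closed⇒Q-all : ∀ {n} p k .{{_ : NonZero k}} → Prime p → ¬ (p ∣ k) → p · 1# ≈ 0# → n ≥ 2 →
    Closed (Q k n) → IsAllWithZero (Q k n)
  Closed⇒Q-all {suc (suc n)} p k pr p∤k p·1≈0 n≥2 C M = choose (zeroOrNonZeroM M)
    where
    choose : (M ≈M 0M) ⊎ NonZeroM M → Q k (suc (suc n)) M ⊎ (M ≈M 0M)
    choose (inj₁ M≈0) = inj₂ M≈0
    choose (inj₂ M≉0) = inj₁ (constant-diagonal C (1# + 1#) (diagonal-2⇒Q p k pr p∤k p·1≈0) M M≉0)
  Closed⇒Q-all {suc zero} p k pr p∤k p·1≈0 (s≤s ()) C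

  pow-0 : ∀ {x} k .{{_ : NonZero k}} → x ≈ 0# → pow x k ≈ 0#
  pow-0 (suc k) x≈0 = trans (*-congʳ x≈0) (zeroˡ _)

  -1≉0 : ¬ (- 1# ≈ 0#)
  -1≉0 eq = 1≉0 (-‿≈0 eq)

  -- The summands are the `k`-th powers of `I` and of the scalar matrix `y`, namely `I` and its
  -- negative.
  Q-0M : ∀ n k .{{_ : NonZero k}} {y} → pow y k ≈ - 1# → Q k n 0M
  Q-0M n k {y} yk≈-1 = I , scalar y , (I , I*I , I*I)
    , scalar-InGL (λ y≈0 → -1≉0 (trans (sym yk≈-1) (pow-0 k y≈0)))
    , λ i j → trans (+-cong (I-^M k i j) (scalar-^M y k i j)) (scalar-+≈0 (trans (+-congˡ yk≈-1) (-‿inverseʳ 1#)) i j)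
    where
    I*I : (I {n} *M I) ≈M I
    I*I = Monoid.identityˡ (*M-monoid n) I

-1-k-power : ∀ {q} (F : FiniteField q) → let open FiniteField F; open Matrices F in
  ∀ k .{{_ : NonZero k}} → (∃ λ x → pow x (gcd k (q ∸ 1)) ≈ - 1#) → ∃ λ y → pow y k ≈ - 1#
-1-k-power {zero} F k (x , _) with () ← proj₁ (FiniteField.enum-surjective F x)
-1-k-power {suc m} F k {{k≢0}} (x , xd≈-1) =
  let (y , yk≈) = Fermat.gcd-power⇒k-power F k x≉0 in y , trans yk≈ xd≈-1
  where
  open FiniteField F
  open PowerSums F
  x≉0 : ¬ (x ≈ 0#)
  x≉0 x≈0 = -1≉0 (trans (sym xd≈-1) (pow-0 (gcd k m) {{ℕ.≢-nonZero (gcd[m,n]≢0 k m (inj₁ (ℕ.≢-nonZero⁻¹ k)))}} x≈0))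

theorem1p1 : (p l q n k : ℕ) → Prime p → q ≡ p ^ l → (F : FiniteField q)
    → n ≥ 2 → k ≥ 1 → ¬ (n ≡ 2 × q ≡ 2) → ¬ (n ≡ 2 × q ≡ 3)
    → (g : Matrices.Mat F n) → Matrices.InSL F g → ¬ Matrices.InZ F n g
    → (Matrices.IsAll F (Matrices.P F k n) ⇔ Matrices.InL F (Matrices.P F k n) g)
    × (¬ (p ∣ k)
    → (∃ λ x → FiniteField._≈_ F (Matrices.pow F x (gcd k (q ∸ 1))) (FiniteField.-_ F (FiniteField.1# F)))
    → (Matrices.IsAll F (Matrices.Q F k n) ⇔ Matrices.InL F (Matrices.Q F k n) g))
    × (¬ (p ∣ k)
    → (Matrices.IsAllWithZero F (Matrices.Q F k n) ⇔ Matrices.InL F (Matrices.Q F k n) g))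
theorem1p1 p l q n k pr q≡p^l F n≥2 k≥1 ¬22 ¬23 g g∈SL g∉Z =
    mk⇔ (IsAll⇒InL g∈GL) (λ Lg → Closed⇒P-all k n≥2 (InL⇒Closed (P-invariant k) n≥2 big g∈SL g∉Z Lg))
  , (λ p∤k -1-power → mk⇔ (IsAll⇒InL g∈GL) (λ Lg M → fill M (-1-k-power F k -1-power) (Q-all p∤k Lg M)))
  , (λ p∤k → mk⇔ (IsAllWithZero⇒InL (Q-invariant k) g∈GL) (Q-all p∤k))
  where
  open FiniteField F hiding (zero)
  open Matrices F
  open NormalSubgroups F
  open LinearAlgebra F
  open Characteristic F
  open PowerSums F
  instance
    k-nonZero : NonZero k
    k-nonZero = ℕ.>-nonZero k≥1
  g∈GL : InGL g
  g∈GL = InSL⇒InGL g∈SL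
  big : n ≡ 2 → 4 ℕ.≤ q
  big n≡2 = q≥4 F (λ q≡2 → ¬22 (n≡2 , q≡2)) (λ q≡3 → ¬23 (n≡2 , q≡3))
  Q-all : ¬ (p ∣ k) → InL (Q k n) g → IsAllWithZero (Q k n)
  Q-all p∤k Lg = Closed⇒Q-all p k pr p∤k
    -- The field has characteristic `p`: its order `q = p ^ l` annihilates `1#`.
    (p^l·1≈0⇒p·1≈0 p l (≡.subst (λ m → m · 1# ≈ 0#) q≡p^l q·1≈0)) n≥2 (InL⇒Closed (Q-invariant k) n≥2 big g∈SL g∉Z Lg)
  -- Turns (c) into (b): only the zero matrix is still open, and a `k`-th root of -1 settles it.
  fill : ∀ M → (∃ λ y → pow y k ≈ - 1#) → Q k n M ⊎ (M ≈M 0M) → Q k n M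
  fill M (y , yk≈-1) (inj₁ QM)  = QM
  fill M (y , yk≈-1) (inj₂ M≈0) = ConjugationInvariant.S-resp (Q-invariant k) (≈M-sym M≈0) (Q-0M n k yk≈-1)
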